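{- Let $a,b\ge1$ and $P=[a]\times[b]$. Then $\sum_{p\in P}T_p^-\equiv^q \frac{[a]_q[b]_q}{[a+b]_q}$.
   Context: $[a]\times[b]=\{(i,j)\colon1\le i\le a,1\le j\le b\}$ with $(i,j)\le(i',j')$ iff $i\le i'$ and $j\le j'$. $\mathcal{J}(P)$ is the set of order ideals. For $p\in P$, $I\in\mathcal{J}(P)$: $T_p^+(I)=1$ if $p$ is minimal in $P\setminus I$, else $0$; $T_p^-(I)=1$ if $p$ is maximal in $I$, else $0$; $T_p^q=T_p^+-qT_p^-$ with $q$ an indeterminate. For $f,g\colon\mathcal{J}(P)\to\mathbb{R}(q)$, $f\equiv^q g$ means $f-g=\sum_{p\in P}c_p(q)T_p^q$ for some $c_p(q)\in\mathbb{R}(q)$; an element of $\mathbb{R}(q)$ denotes a constant function. $[m]_q=1+q+\dots+q^{m-1}$. -}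

module Defs where

open import Level using (0ℓ)
open import Algebra.Bundles using (CommutativeRing)
open import Algebra.Bundles.Raw using (RawRing; RawMonoid)
import Algebra.Definitions.RawMonoid as RawMonoidDefs
open import Data.Bool.Base using (Bool; T; if_then_else_)
open import Data.Bool.Properties using (T?)
open import Data.Fin.Base as Fin using (Fin)
import Data.Fin.Properties as Fin
open import Data.List.Base as List using (List; []; _∷_)
open import Data.Nat.Base as ℕ using (ℕ; zero; suc)
import Data.Nat.Properties as ℕ
open import Data.Product.Base using (Σ-syntax; ∃-syntax; _×_; _,_; proj₁; proj₂)
open import Data.Product.Properties using (≡-dec)
open import Data.Product.Relation.Binary.Pointwise.NonDependent
  using (Pointwise; ×-decidable)
open import Data.Rational as ℚ using (ℚ; 0ℚ; 1ℚ; ½; ∣_∣)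
import Data.Rational.Properties as ℚ
open import Data.Rational.Solver using (module +-*-Solver)
open import Relation.Binary.Core using (Rel)
open import Relation.Binary.Definitions using (Decidable)
open import Relation.Binary.PropositionalEquality as ≡ using (_≡_)
open import Relation.Nullary.Decidable using (Dec; yes; no; does; ¬¬-excluded-middle; map′; _×-dec_; _→-dec_; ¬?)
open import Relation.Nullary.Negation using (¬_; contradiction)

-- The reals are Cauchy sequences of rationals carrying a modulus, taken up to
-- _≃_.  Without eta, and with the operations given by copatterns, conversion
-- checking never has to compare moduli.
record ℝ : Set where
  no-eta-equality
  constructor mkℝ
  field
    approx : ℕ → ℚ
    cauchy : ∀ ε → 0ℚ ℚ.< ε → ∃[ N ] ∀ m n → N ℕ.≤ m → N ℕ.≤ n →
             ∣ approx m ℚ.- approx n ∣ ℚ.< ε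

open ℝ public

infix 4 _≃_

record _≃_ (x y : ℝ) : Set where
  no-eta-equality
  constructor mk≃
  field
    close : ∀ ε → 0ℚ ℚ.< ε → ∃[ N ] ∀ n → N ℕ.≤ n →
            ∣ approx x n ℚ.- approx y n ∣ ℚ.< ε

open _≃_ public

private
  open +-*-Solver using (solve; _:+_; _:*_; _:-_; :-_; _:=_; con)

  half-pos : ∀ {ε} → 0ℚ ℚ.< ε → 0ℚ ℚ.< ½ ℚ.* ε
  half-pos {ε} 0<ε = ≡.subst (ℚ._< ½ ℚ.* ε) (ℚ.*-zeroʳ ½) (ℚ.*-monoʳ-<-pos ½ 0<ε)

  half+half : ∀ ε → ½ ℚ.* ε ℚ.+ ½ ℚ.* ε ≡ ε
  half+half = solve 1 (λ e → con ½ :* e :+ con ½ :* e := e) ≡.refl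

  ∣p-p∣<ε : ∀ p {ε} → 0ℚ ℚ.< ε → ∣ p ℚ.- p ∣ ℚ.< ε
  ∣p-p∣<ε p {ε} 0<ε = ≡.subst (λ r → ∣ r ∣ ℚ.< ε) (≡.sym (ℚ.+-inverseʳ p)) 0<ε

  ∣-∣-sym : ∀ p r → ∣ p ℚ.- r ∣ ≡ ∣ r ℚ.- p ∣
  ∣-∣-sym p r = ≡.trans
    (≡.cong ∣_∣ (solve 2 (λ p r → p :- r := :- (r :- p)) ≡.refl p r))
    (ℚ.∣-p∣≡∣p∣ (r ℚ.- p))

  ∣p-0∣ : ∀ p → ∣ p ℚ.- 0ℚ ∣ ≡ ∣ p ∣
  ∣p-0∣ p = ≡.cong ∣_∣ (solve 1 (λ p → p :- con 0ℚ := p) ≡.refl p)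

  sum-close : ∀ u v {ε} → ∣ u ∣ ℚ.< ½ ℚ.* ε → ∣ v ∣ ℚ.< ½ ℚ.* ε → ∣ u ℚ.+ v ∣ ℚ.< ε
  sum-close u v {ε} p r = begin-strict
    ∣ u ℚ.+ v ∣          ≤⟨ ℚ.∣p+q∣≤∣p∣+∣q∣ u v ⟩
    ∣ u ∣ ℚ.+ ∣ v ∣      <⟨ ℚ.+-mono-< p r ⟩
    ½ ℚ.* ε ℚ.+ ½ ℚ.* ε  ≡⟨ half+half ε ⟩
    ε                    ∎
    where open ℚ.≤-Reasoning

  triangle : ∀ u v w {ε} → ∣ u ℚ.- v ∣ ℚ.< ½ ℚ.* ε → ∣ v ℚ.- w ∣ ℚ.< ½ ℚ.* ε →
             ∣ u ℚ.- w ∣ ℚ.< ε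
  triangle u v w {ε} p r = ≡.subst (λ t → ∣ t ∣ ℚ.< ε)
    (solve 3 (λ u v w → (u :- v) :+ (v :- w) := u :- w) ≡.refl u v w)
    (sum-close (u ℚ.- v) (v ℚ.- w) p r)

  +-close : ∀ a b c d {ε} → ∣ a ℚ.- c ∣ ℚ.< ½ ℚ.* ε → ∣ b ℚ.- d ∣ ℚ.< ½ ℚ.* ε →
            ∣ (a ℚ.+ b) ℚ.- (c ℚ.+ d) ∣ ℚ.< ε
  +-close a b c d {ε} p r = ≡.subst (λ t → ∣ t ∣ ℚ.< ε)
    (solve 4 (λ a b c d → (a :- c) :+ (b :- d) := (a :+ b) :- (c :+ d)) ≡.refl a b c d)
    (sum-close (a ℚ.- c) (b ℚ.- d) p r)

  neg-close : ∀ a b {ε} → ∣ a ℚ.- b ∣ ℚ.< ε → ∣ ℚ.- a ℚ.- ℚ.- b ∣ ℚ.< ε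
  neg-close a b {ε} = ≡.subst (ℚ._< ε) (≡.trans (∣-∣-sym a b)
    (≡.cong ∣_∣ (solve 2 (λ a b → b :- a := (:- a) :- (:- b)) ≡.refl a b)))

  *-close : ∀ a b c d {B C δ} → ∣ a ∣ ℚ.< B → ∣ d ∣ ℚ.< C →
            ∣ a ℚ.- c ∣ ℚ.< δ → ∣ b ℚ.- d ∣ ℚ.< δ →
            ∣ a ℚ.* b ℚ.- c ℚ.* d ∣ ℚ.< (B ℚ.+ C) ℚ.* δ
  *-close a b c d {B} {C} {δ} a<B d<C ac bd = begin-strict
    ∣ a ℚ.* b ℚ.- c ℚ.* d ∣
      ≡⟨ ≡.cong ∣_∣ (solve 4 (λ a b c d → a :* b :- c :* d := a :* (b :- d) :+ (a :- c) :* d) ≡.refl a b c d) ⟩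
    ∣ a ℚ.* (b ℚ.- d) ℚ.+ (a ℚ.- c) ℚ.* d ∣
      ≤⟨ ℚ.∣p+q∣≤∣p∣+∣q∣ (a ℚ.* (b ℚ.- d)) ((a ℚ.- c) ℚ.* d) ⟩
    ∣ a ℚ.* (b ℚ.- d) ∣ ℚ.+ ∣ (a ℚ.- c) ℚ.* d ∣
      ≡⟨ ≡.cong₂ ℚ._+_ (ℚ.∣p*q∣≡∣p∣*∣q∣ a (b ℚ.- d)) (ℚ.∣p*q∣≡∣p∣*∣q∣ (a ℚ.- c) d) ⟩
    ∣ a ∣ ℚ.* ∣ b ℚ.- d ∣ ℚ.+ ∣ a ℚ.- c ∣ ℚ.* ∣ d ∣
      <⟨ ℚ.+-mono-< (mul a (b ℚ.- d) a<B bd) (mul (a ℚ.- c) d ac d<C) ⟩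
    B ℚ.* δ ℚ.+ δ ℚ.* C
      ≡⟨ solve 3 (λ B C δ → B :* δ :+ δ :* C := (B :+ C) :* δ) ≡.refl B C δ ⟩
    (B ℚ.+ C) ℚ.* δ ∎
    where
    open ℚ.≤-Reasoning
    mul : ∀ u v {U V} → ∣ u ∣ ℚ.< U → ∣ v ∣ ℚ.< V → ∣ u ∣ ℚ.* ∣ v ∣ ℚ.< U ℚ.* V
    mul u v {U} {V} u<U v<V = begin-strict
      ∣ u ∣ ℚ.* ∣ v ∣  ≤⟨ ℚ.*-monoʳ-≤-nonNeg ∣ v ∣ {{ℚ.∣-∣-nonNeg v}} (ℚ.<⇒≤ u<U) ⟩
      U ℚ.* ∣ v ∣      <⟨ ℚ.*-monoʳ-<-pos U {{ℚ.positive (ℚ.≤-<-trans (ℚ.0≤∣p∣ u) u<U)}} v<V ⟩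
      U ℚ.* V          ∎

  bounded : ∀ x → ∃[ B ] 0ℚ ℚ.< B × ∃[ N ] ∀ n → N ℕ.≤ n → ∣ approx x n ∣ ℚ.< B
  bounded x with cauchy x 1ℚ (ℚ.positive⁻¹ 1ℚ)
  ... | N , c = B , ℚ.≤-<-trans (ℚ.0≤∣p∣ (approx x N)) (bd N ℕ.≤-refl) , N , bd
    where
    B = 1ℚ ℚ.+ ∣ approx x N ∣
    bd : ∀ n → N ℕ.≤ n → ∣ approx x n ∣ ℚ.< B
    bd n N≤n = begin-strict
      ∣ approx x n ∣
        ≡⟨ ≡.cong ∣_∣ (solve 2 (λ u v → u := (u :- v) :+ v) ≡.refl (approx x n) (approx x N)) ⟩
      ∣ (approx x n ℚ.- approx x N) ℚ.+ approx x N ∣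
        ≤⟨ ℚ.∣p+q∣≤∣p∣+∣q∣ (approx x n ℚ.- approx x N) (approx x N) ⟩
      ∣ approx x n ℚ.- approx x N ∣ ℚ.+ ∣ approx x N ∣
        <⟨ ℚ.+-monoˡ-< ∣ approx x N ∣ (c n N N≤n ℕ.≤-refl) ⟩
      B ∎
      where open ℚ.≤-Reasoning

  divide : ∀ B ε → 0ℚ ℚ.< B → 0ℚ ℚ.< ε → ∃[ δ ] 0ℚ ℚ.< δ × B ℚ.* δ ≡ ε
  divide B ε 0<B 0<ε =
    ℚ.1/ B ℚ.* ε , ℚ.positive⁻¹ _ {{ℚ.pos*pos⇒pos (ℚ.1/ B) ε}} ,
    ≡.trans (≡.sym (ℚ.*-assoc B (ℚ.1/ B) ε))
      (≡.trans (≡.cong (ℚ._* ε) (ℚ.*-inverseʳ B)) (ℚ.*-identityˡ ε))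
    where
    instance
      B-pos = ℚ.positive 0<B
      ε-pos = ℚ.positive 0<ε
      B-nz  = ℚ.pos⇒nonZero B
      1/B-pos = ℚ.1/pos⇒pos B

  ⊔ˡ : ∀ {k} M N → M ℕ.⊔ N ℕ.≤ k → M ℕ.≤ k
  ⊔ˡ M N = ℕ.≤-trans (ℕ.m≤m⊔n M N)

  ⊔ʳ : ∀ {k} M N → M ℕ.⊔ N ℕ.≤ k → N ℕ.≤ k
  ⊔ʳ M N = ℕ.≤-trans (ℕ.m≤n⊔m M N)

infixl 6 _+ᴿ_
infixl 7 _*ᴿ_
infix  8 -ᴿ_

private
  Cauchy : (ℕ → ℚ) → Set
  Cauchy s = ∀ ε → 0ℚ ℚ.< ε → ∃[ N ] ∀ m n → N ℕ.≤ m → N ℕ.≤ n → ∣ s m ℚ.- s n ∣ ℚ.< ε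

  const-cauchy : ∀ p → Cauchy (λ _ → p)
  const-cauchy p ε 0<ε = 0 , λ _ _ _ _ → ∣p-p∣<ε p 0<ε

  +-cauchy : ∀ x y → Cauchy (λ n → approx x n ℚ.+ approx y n)
  +-cauchy x y ε 0<ε =
    let M , c = cauchy x (½ ℚ.* ε) (half-pos 0<ε)
        N , d = cauchy y (½ ℚ.* ε) (half-pos 0<ε)
    in M ℕ.⊔ N , λ m n p r →
       +-close (approx x m) (approx y m) (approx x n) (approx y n)
         (c m n (⊔ˡ M N p) (⊔ˡ M N r)) (d m n (⊔ʳ M N p) (⊔ʳ M N r))

  neg-cauchy : ∀ x → Cauchy (λ n → ℚ.- approx x n)
  neg-cauchy x ε 0<ε =
    let N , c = cauchy x ε 0<ε
    in N , λ m n p r → neg-close (approx x m) (approx x n) (c m n p r)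

  *-cauchy : ∀ x y → Cauchy (λ n → approx x n ℚ.* approx y n)
  *-cauchy x y ε 0<ε =
    let B , 0<B , K , x<B = bounded x
        C , 0<C , L , y<C = bounded y
        δ , 0<δ , eq = divide (B ℚ.+ C) ε (ℚ.+-mono-< 0<B 0<C) 0<ε
        M , c = cauchy x δ 0<δ
        N , d = cauchy y δ 0<δ
    in (K ℕ.⊔ L) ℕ.⊔ (M ℕ.⊔ N) , λ m n p r →
       ≡.subst (∣ approx x m ℚ.* approx y m ℚ.- approx x n ℚ.* approx y n ∣ ℚ.<_) eq
         (*-close (approx x m) (approx y m) (approx x n) (approx y n)
                  (x<B m (⊔ˡ K L (⊔ˡ (K ℕ.⊔ L) (M ℕ.⊔ N) p)))
                  (y<C n (⊔ʳ K L (⊔ˡ (K ℕ.⊔ L) (M ℕ.⊔ N) r)))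
                  (c m n (⊔ˡ M N (⊔ʳ (K ℕ.⊔ L) (M ℕ.⊔ N) p)) (⊔ˡ M N (⊔ʳ (K ℕ.⊔ L) (M ℕ.⊔ N) r)))
                  (d m n (⊔ʳ M N (⊔ʳ (K ℕ.⊔ L) (M ℕ.⊔ N) p)) (⊔ʳ M N (⊔ʳ (K ℕ.⊔ L) (M ℕ.⊔ N) r))))

fromℚ : ℚ → ℝ
approx (fromℚ p) n = p
cauchy (fromℚ p)   = const-cauchy p

0ᴿ 1ᴿ : ℝ
0ᴿ = fromℚ 0ℚ
1ᴿ = fromℚ 1ℚ

_+ᴿ_ : ℝ → ℝ → ℝ
approx (x +ᴿ y) n = approx x n ℚ.+ approx y n
cauchy (x +ᴿ y)   = +-cauchy x y

-ᴿ_ : ℝ → ℝ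
approx (-ᴿ x) n = ℚ.- approx x n
cauchy (-ᴿ x)   = neg-cauchy x

_*ᴿ_ : ℝ → ℝ → ℝ
approx (x *ᴿ y) n = approx x n ℚ.* approx y n
cauchy (x *ᴿ y)   = *-cauchy x y

private
  pointwise : ∀ {x y} → (∀ n → approx x n ≡ approx y n) → x ≃ y
  pointwise {x} {y} eq = mk≃ λ ε 0<ε → 0 , λ n _ →
    ≡.subst (λ t → ∣ approx x n ℚ.- t ∣ ℚ.< ε) (eq n) (∣p-p∣<ε (approx x n) 0<ε)

  ≃-refl : ∀ {x} → x ≃ x
  ≃-refl = pointwise λ _ → ≡.refl

  ≃-sym : ∀ {x y} → x ≃ y → y ≃ x
  ≃-sym {x} {y} e = mk≃ λ ε 0<ε →
    let N , c = close e ε 0<ε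
    in N , λ n p → ≡.subst (ℚ._< ε) (∣-∣-sym (approx x n) (approx y n)) (c n p)

  ≃-trans : ∀ {x y z} → x ≃ y → y ≃ z → x ≃ z
  ≃-trans {x} {y} {z} e f = mk≃ λ ε 0<ε →
    let M , c = close e (½ ℚ.* ε) (half-pos 0<ε)
        N , d = close f (½ ℚ.* ε) (half-pos 0<ε)
    in M ℕ.⊔ N , λ n p →
       triangle (approx x n) (approx y n) (approx z n) (c n (⊔ˡ M N p)) (d n (⊔ʳ M N p))

  +ᴿ-cong : ∀ {x x′ y y′} → x ≃ x′ → y ≃ y′ → x +ᴿ y ≃ x′ +ᴿ y′
  +ᴿ-cong {x} {x′} {y} {y′} e f = mk≃ λ ε 0<ε →
    let M , c = close e (½ ℚ.* ε) (half-pos 0<ε)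
        N , d = close f (½ ℚ.* ε) (half-pos 0<ε)
    in M ℕ.⊔ N , λ n p →
       +-close (approx x n) (approx y n) (approx x′ n) (approx y′ n) (c n (⊔ˡ M N p)) (d n (⊔ʳ M N p))

  -ᴿ-cong : ∀ {x y} → x ≃ y → -ᴿ x ≃ -ᴿ y
  -ᴿ-cong {x} {y} e = mk≃ λ ε 0<ε →
    let N , c = close e ε 0<ε
    in N , λ n p → neg-close (approx x n) (approx y n) (c n p)

  *ᴿ-cong : ∀ {x x′ y y′} → x ≃ x′ → y ≃ y′ → x *ᴿ y ≃ x′ *ᴿ y′
  *ᴿ-cong {x} {x′} {y} {y′} e f = mk≃ λ ε 0<ε →
    let B , 0<B , K , x<B = bounded x
        C , 0<C , L , y<C = bounded y′
        δ , 0<δ , eq = divide (B ℚ.+ C) ε (ℚ.+-mono-< 0<B 0<C) 0<ε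
        M , c = close e δ 0<δ
        N , d = close f δ 0<δ
    in (K ℕ.⊔ L) ℕ.⊔ (M ℕ.⊔ N) , λ n p →
       ≡.subst (∣ approx x n ℚ.* approx y n ℚ.- approx x′ n ℚ.* approx y′ n ∣ ℚ.<_) eq
         (*-close (approx x n) (approx y n) (approx x′ n) (approx y′ n)
                  (x<B n (⊔ˡ K L (⊔ˡ (K ℕ.⊔ L) (M ℕ.⊔ N) p)))
                  (y<C n (⊔ʳ K L (⊔ˡ (K ℕ.⊔ L) (M ℕ.⊔ N) p)))
                  (c n (⊔ˡ M N (⊔ʳ (K ℕ.⊔ L) (M ℕ.⊔ N) p)))
                  (d n (⊔ʳ M N (⊔ʳ (K ℕ.⊔ L) (M ℕ.⊔ N) p))))

ℝ-commutativeRing : CommutativeRing 0ℓ 0ℓ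
ℝ-commutativeRing = record
  { Carrier = ℝ
  ; _≈_ = _≃_
  ; _+_ = _+ᴿ_
  ; _*_ = _*ᴿ_
  ; -_ = -ᴿ_
  ; 0# = 0ᴿ
  ; 1# = 1ᴿ
  ; isCommutativeRing = record
    { isRing = record
      { +-isAbelianGroup = record
        { isGroup = record
          { isMonoid = record
            { isSemigroup = record
              { isMagma = record
                { isEquivalence = record { refl = ≃-refl ; sym = ≃-sym ; trans = ≃-trans }
                ; ∙-cong = +ᴿ-cong
                }
              ; assoc = λ x y z → pointwise λ n → ℚ.+-assoc (approx x n) (approx y n) (approx z n)
              }
            ; identity = (λ x → pointwise λ n → ℚ.+-identityˡ (approx x n))
                       , (λ x → pointwise λ n → ℚ.+-identityʳ (approx x n))
            }
          ; inverse = (λ x → pointwise λ n → ℚ.+-inverseˡ (approx x n))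
                    , (λ x → pointwise λ n → ℚ.+-inverseʳ (approx x n))
          ; ⁻¹-cong = -ᴿ-cong
          }
        ; comm = λ x y → pointwise λ n → ℚ.+-comm (approx x n) (approx y n)
        }
      ; *-cong = *ᴿ-cong
      ; *-assoc = λ x y z → pointwise λ n → ℚ.*-assoc (approx x n) (approx y n) (approx z n)
      ; *-identity = (λ x → pointwise λ n → ℚ.*-identityˡ (approx x n))
                   , (λ x → pointwise λ n → ℚ.*-identityʳ (approx x n))
      ; distrib = (λ x y z → pointwise λ n → ℚ.*-distribˡ-+ (approx x n) (approx y n) (approx z n))
                , (λ x y z → pointwise λ n → ℚ.*-distribʳ-+ (approx x n) (approx y n) (approx z n))
      }
    ; *-comm = λ x y → pointwise λ n → ℚ.*-comm (approx x n) (approx y n)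
    }
  }

1ᴿ≄0ᴿ : ¬ 1ᴿ ≃ 0ᴿ
1ᴿ≄0ᴿ e with close e 1ℚ (ℚ.positive⁻¹ 1ℚ)
... | N , c = ℚ.<-irrefl ≡.refl (c N ℕ.≤-refl)

*ᴿ-≄0 : ∀ x y → ¬ x ≃ 0ᴿ → ¬ y ≃ 0ᴿ → ¬ x *ᴿ y ≃ 0ᴿ
*ᴿ-≄0 x y x≄0 y≄0 xy≃0 = x≄0 (mk≃ x-small)
  where
  open ℚ.≤-Reasoning

  x-small : ∀ ε → 0ℚ ℚ.< ε → ∃[ N ] ∀ n → N ℕ.≤ n → ∣ approx x n ℚ.- 0ℚ ∣ ℚ.< ε
  x-small ε 0<ε = helper (cauchy x η (half-pos 0<ε))
    where
    η = ½ ℚ.* ε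
    θ = ½ ℚ.* η

    helper : ∃[ N ] (∀ m n → N ℕ.≤ m → N ℕ.≤ n → ∣ approx x m ℚ.- approx x n ∣ ℚ.< η) →
             ∃[ N ] ∀ n → N ℕ.≤ n → ∣ approx x n ℚ.- 0ℚ ∣ ℚ.< ε
    helper (N , c) with cauchy x θ (half-pos (half-pos 0<ε))
    ... | M , d with ∣ approx x (M ℕ.⊔ N) ∣ ℚ.<? η
    ... | yes small = M ℕ.⊔ N , λ n p →
      triangle (approx x n) (approx x (M ℕ.⊔ N)) 0ℚ (c n (M ℕ.⊔ N) (⊔ʳ M N p) (ℕ.m≤n⊔m M N))
        (≡.subst (ℚ._< η) (≡.sym (∣p-0∣ _)) small)
    ... | no large = contradiction (mk≃ y-small) y≄0
      where
      K = M ℕ.⊔ N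

      below : ∀ n → M ℕ.≤ n → θ ℚ.< ∣ approx x n ∣
      below n p = ℚ.≰⇒> λ x≤θ → large (begin-strict
        ∣ approx x K ∣
          ≡⟨ ≡.cong ∣_∣ (solve 2 (λ u v → u := (u :- v) :+ v) ≡.refl (approx x K) (approx x n)) ⟩
        ∣ (approx x K ℚ.- approx x n) ℚ.+ approx x n ∣
          ≤⟨ ℚ.∣p+q∣≤∣p∣+∣q∣ (approx x K ℚ.- approx x n) (approx x n) ⟩
        ∣ approx x K ℚ.- approx x n ∣ ℚ.+ ∣ approx x n ∣
          <⟨ ℚ.+-mono-<-≤ (d K n (ℕ.m≤m⊔n M N) p) x≤θ ⟩
        θ ℚ.+ θ
          ≡⟨ half+half η ⟩
        η ∎)

      instance
        θ-pos = ℚ.positive (half-pos (half-pos 0<ε))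

      y-small : ∀ δ → 0ℚ ℚ.< δ → ∃[ L ] ∀ n → L ℕ.≤ n → ∣ approx y n ℚ.- 0ℚ ∣ ℚ.< δ
      y-small δ 0<δ with close xy≃0 (θ ℚ.* δ) (ℚ.positive⁻¹ _ {{ℚ.pos*pos⇒pos θ δ {{ℚ.positive 0<δ}}}})
      ... | L , e = M ℕ.⊔ L , λ n p →
        ≡.subst (ℚ._< δ) (≡.sym (∣p-0∣ (approx y n))) (ℚ.≰⇒> λ δ≤y →
          ℚ.<-irrefl ≡.refl (begin-strict
            θ ℚ.* δ
              ≤⟨ ℚ.*-monoˡ-≤-nonNeg θ {{ℚ.pos⇒nonNeg θ}} δ≤y ⟩
            θ ℚ.* ∣ approx y n ∣
              ≤⟨ ℚ.*-monoʳ-≤-nonNeg ∣ approx y n ∣ {{ℚ.∣-∣-nonNeg (approx y n)}} (ℚ.<⇒≤ (below n (⊔ˡ M L p))) ⟩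
            ∣ approx x n ∣ ℚ.* ∣ approx y n ∣
              ≡⟨ ℚ.∣p*q∣≡∣p∣*∣q∣ (approx x n) (approx y n) ⟨
            ∣ approx x n ℚ.* approx y n ∣
              ≡⟨ ∣p-0∣ (approx x n ℚ.* approx y n) ⟨
            ∣ approx x n ℚ.* approx y n ℚ.- 0ℚ ∣
              <⟨ e n (⊔ʳ M L p) ⟩
            θ ℚ.* δ ∎))

module Polynomial (R : CommutativeRing 0ℓ 0ℓ) where
  private module R = CommutativeRing R
  open R using (Carrier; _≈_; 0#; 1#)

  -- c₀ ∷ c₁ ∷ ⋯ ∷ cₙ ∷ [] is c₀ + c₁ q + ⋯ + cₙ qⁿ; trailing zeros are
  -- allowed, so polynomials are compared coefficientwise.
  Poly : Set
  Poly = List Carrier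

  coeff : Poly → ℕ → Carrier
  coeff []      n       = 0#
  coeff (c ∷ f) zero    = c
  coeff (c ∷ f) (suc n) = coeff f n

  infix 4 _≋_

  record _≋_ (f g : Poly) : Set where
    no-eta-equality
    constructor mk≋
    field coeff-≈ : ∀ n → coeff f n ≈ coeff g n

  open _≋_ public

  infixl 6 _+ᴾ_
  infixl 7 _*ᴾ_ _·ᴾ_
  infix  8 -ᴾ_

  0ᴾ 1ᴾ X : Poly
  0ᴾ = []
  1ᴾ = 1# ∷ []
  X  = 0# ∷ 1# ∷ []

  _+ᴾ_ : Poly → Poly → Poly
  []      +ᴾ g       = g
  (c ∷ f) +ᴾ []      = c ∷ f
  (c ∷ f) +ᴾ (d ∷ g) = (c R.+ d) ∷ (f +ᴾ g)

  _·ᴾ_ : Carrier → Poly → Poly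
  c ·ᴾ g = List.map (c R.*_) g

  -ᴾ_ : Poly → Poly
  -ᴾ f = List.map R.-_ f

  -- (c + q f) g = c g + q (f g)
  _*ᴾ_ : Poly → Poly → Poly
  []      *ᴾ g = []
  (c ∷ f) *ᴾ g = (c ·ᴾ g) +ᴾ (0# ∷ (f *ᴾ g))

  rawRing : RawRing 0ℓ 0ℓ
  rawRing = record
    { Carrier = Poly
    ; _≈_ = _≋_
    ; _+_ = _+ᴾ_
    ; _*_ = _*ᴾ_
    ; -_ = -ᴾ_
    ; 0# = 0ᴾ
    ; 1# = 1ᴾ
    }

  private
    coeff-+ : ∀ f g n → coeff (f +ᴾ g) n ≈ coeff f n R.+ coeff g n
    coeff-+ []      g       n       = R.sym (R.+-identityˡ _)
    coeff-+ (c ∷ f) []      n       = R.sym (R.+-identityʳ _)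
    coeff-+ (c ∷ f) (d ∷ g) zero    = R.refl
    coeff-+ (c ∷ f) (d ∷ g) (suc n) = coeff-+ f g n

    coeff-· : ∀ c g n → coeff (c ·ᴾ g) n ≈ c R.* coeff g n
    coeff-· c []      n       = R.sym (R.zeroʳ c)
    coeff-· c (d ∷ g) zero    = R.refl
    coeff-· c (d ∷ g) (suc n) = coeff-· c g n

    coeff-* : ∀ c f g n →
              coeff ((c ∷ f) *ᴾ g) n ≈ c R.* coeff g n R.+ coeff (0# ∷ (f *ᴾ g)) n
    coeff-* c f g n = R.trans (coeff-+ (c ·ᴾ g) (0# ∷ (f *ᴾ g)) n) (R.+-congʳ (coeff-· c g n))

    coeff-*-zeroˡ : ∀ {c} f g n → c ≈ 0# →
                    coeff ((c ∷ f) *ᴾ g) n ≈ coeff (0# ∷ (f *ᴾ g)) n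
    coeff-*-zeroˡ {c} f g n c≈0 = R.trans (coeff-* c f g n)
      (R.trans (R.+-congʳ (R.trans (R.*-congʳ c≈0) (R.zeroˡ _))) (R.+-identityˡ _))

    coeff-*-zeroʳ : ∀ {d} f g n → d ≈ 0# →
                    coeff (f *ᴾ (d ∷ g)) n ≈ coeff (0# ∷ (f *ᴾ g)) n
    coeff-*-zeroʳ []      g zero    d≈0 = R.refl
    coeff-*-zeroʳ []      g (suc n) d≈0 = R.refl
    coeff-*-zeroʳ {d} (c ∷ f) g zero d≈0 = R.trans (coeff-* c f (d ∷ g) zero)
      (R.trans (R.+-identityʳ _) (R.trans (R.*-congˡ d≈0) (R.zeroʳ c)))
    coeff-*-zeroʳ {d} (c ∷ f) g (suc n) d≈0 = R.trans (coeff-* c f (d ∷ g) (suc n))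
      (R.trans (R.+-congˡ (coeff-*-zeroʳ f g n d≈0)) (R.sym (coeff-* c f g n)))

    ∷-≋0 : ∀ {c f} → c ≈ 0# → f ≋ 0ᴾ → (c ∷ f) ≋ 0ᴾ
    ∷-≋0 c≈0 f≋0 = mk≋ λ { zero → c≈0 ; (suc n) → coeff-≈ f≋0 n }

  module _ (*-≉0 : ∀ x y → ¬ x ≈ 0# → ¬ y ≈ 0# → ¬ x R.* y ≈ 0#) where
    private
      lead : ∀ c f g → ¬ c ≈ 0# → ¬ g ≋ 0ᴾ → ¬ (c ∷ f) *ᴾ g ≋ 0ᴾ
      lead c f []      c≉0 g≉0 fg≋0 = g≉0 (mk≋ λ _ → R.refl)
      lead c f (d ∷ g) c≉0 g≉0 fg≋0 = ¬¬-excluded-middle λ where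
        (yes d≈0) → lead c f g c≉0 (λ g≋0 → g≉0 (∷-≋0 d≈0 g≋0))
          (mk≋ λ n → R.trans (R.sym (coeff-*-zeroʳ (c ∷ f) g (suc n) d≈0)) (coeff-≈ fg≋0 (suc n)))
        (no d≉0) → *-≉0 c d c≉0 d≉0
          (R.trans (R.sym (R.trans (coeff-* c f (d ∷ g) zero) (R.+-identityʳ _))) (coeff-≈ fg≋0 zero))

    *ᴾ-≉0 : ∀ f g → ¬ f ≋ 0ᴾ → ¬ g ≋ 0ᴾ → ¬ f *ᴾ g ≋ 0ᴾ
    *ᴾ-≉0 []      g f≉0 g≉0 fg≋0 = f≉0 (mk≋ λ _ → R.refl)
    *ᴾ-≉0 (c ∷ f) g f≉0 g≉0 fg≋0 = ¬¬-excluded-middle λ where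
      (yes c≈0) → *ᴾ-≉0 f g (λ f≋0 → f≉0 (∷-≋0 c≈0 f≋0)) g≉0
        (mk≋ λ n → R.trans (R.sym (coeff-*-zeroˡ f g (suc n) c≈0)) (coeff-≈ fg≋0 (suc n)))
      (no c≉0) → lead c f g c≉0 g≉0 fg≋0

-- The hypotheses say that D has no zero divisors; fractions are compared by
-- cross-multiplication.
module FractionField
  (D : RawRing 0ℓ 0ℓ)
  (1≉0 : ¬ RawRing._≈_ D (RawRing.1# D) (RawRing.0# D))
  (*-≉0 : ∀ x y → ¬ RawRing._≈_ D x (RawRing.0# D) → ¬ RawRing._≈_ D y (RawRing.0# D) →
          ¬ RawRing._≈_ D (RawRing._*_ D x y) (RawRing.0# D))
  where

  open RawRing D

  infix 5 _/_∣_

  record Frac : Set where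
    no-eta-equality
    constructor _/_∣_
    field
      num   : Carrier
      den   : Carrier
      den≉0 : ¬ den ≈ 0#

  open Frac public

  infix 4 _≈ᶠ_

  record _≈ᶠ_ (x y : Frac) : Set where
    no-eta-equality
    constructor mk≈ᶠ
    field cross : num x * den y ≈ num y * den x

  open _≈ᶠ_ public

  infixl 6 _+ᶠ_ _-ᶠ_
  infixl 7 _*ᶠ_
  infix  8 -ᶠ_

  ι : Carrier → Frac
  ι x = x / 1# ∣ 1≉0

  0ᶠ 1ᶠ : Frac
  0ᶠ = ι 0#
  1ᶠ = ι 1#

  _+ᶠ_ : Frac → Frac → Frac
  num   (x +ᶠ y) = num x * den y + num y * den x
  den   (x +ᶠ y) = den x * den y
  den≉0 (x +ᶠ y) = *-≉0 (den x) (den y) (den≉0 x) (den≉0 y)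

  _*ᶠ_ : Frac → Frac → Frac
  num   (x *ᶠ y) = num x * num y
  den   (x *ᶠ y) = den x * den y
  den≉0 (x *ᶠ y) = *-≉0 (den x) (den y) (den≉0 x) (den≉0 y)

  -ᶠ_ : Frac → Frac
  num   (-ᶠ x) = - num x
  den   (-ᶠ x) = den x
  den≉0 (-ᶠ x) = den≉0 x

  _-ᶠ_ : Frac → Frac → Frac
  x -ᶠ y = x +ᶠ (-ᶠ y)

  +ᶠ-rawMonoid : RawMonoid 0ℓ 0ℓ
  +ᶠ-rawMonoid = record { Carrier = Frac ; _≈_ = _≈ᶠ_ ; _∙_ = _+ᶠ_ ; ε = 0ᶠ }

open Polynomial ℝ-commutativeRing public
  using (coeff; _≋_; mk≋; coeff-≈; _+ᴾ_; _*ᴾ_; _·ᴾ_; -ᴾ_; 0ᴾ; 1ᴾ; X)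
  renaming (Poly to ℝ[q]; rawRing to ℝ[q]-rawRing)

private
  1∷-≉0 : ∀ f → ¬ (1ᴿ ∷ f) ≋ 0ᴾ
  1∷-≉0 f e = 1ᴿ≄0ᴿ (coeff-≈ e 0)

open FractionField ℝ[q]-rawRing (1∷-≉0 [])
  (Polynomial.*ᴾ-≉0 ℝ-commutativeRing *ᴿ-≄0) public
  renaming (Frac to ℝ⟨q⟩)

q : ℝ⟨q⟩
q = ι X

-- The coefficient list 1 ∷ 1 ∷ ⋯ ∷ 1 ∷ [] of 1 + q + ⋯ + q^(m-1).
[_]q : ℕ → ℝ[q]
[ m ]q = List.replicate m 1ᴿ

[_]q-≉0 : ∀ {m} → 1 ℕ.≤ m → ¬ [ m ]q ≋ 0ᴾ
[_]q-≉0 {suc m} _ = 1∷-≉0 [ m ]q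

module _ {P : Set} (_≤_ : Rel P 0ℓ) where

  record OrderIdeal : Set where
    field
      member     : P → Bool
      downClosed : ∀ {p r} → r ≤ p → T (member p) → T (member r)

  MinimalIn MaximalIn : (P → Set) → P → Set
  MinimalIn S p = S p × (∀ r → S r → r ≤ p → r ≡ p)
  MaximalIn S p = S p × (∀ r → S r → p ≤ r → r ≡ p)

open OrderIdeal public

infix 4 _∈_

_∈_ : ∀ {P : Set} {_≤_ : Rel P 0ℓ} → P → OrderIdeal _≤_ → Set
p ∈ I = T (member I p)

-- Fin a = {0, …, a-1} plays the role of {1, …, a}.
[_]×[_] : ℕ → ℕ → Set
[ a ]×[ b ] = Fin a × Fin b

module _ {a b : ℕ} where

  infix 4 _⊑_

  _⊑_ : Rel [ a ]×[ b ] 0ℓ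
  _⊑_ = Pointwise Fin._≤_ Fin._≤_

  private
    _⊑?_ : Decidable _⊑_
    _⊑?_ = ×-decidable Fin._≤?_ Fin._≤?_

    _≟_ : Decidable {A = [ a ]×[ b ]} _≡_
    _≟_ = ≡-dec Fin._≟_ Fin._≟_

    all? : ∀ {S : [ a ]×[ b ] → Set} → (∀ p → Dec (S p)) → Dec (∀ p → S p)
    all? S? = map′ (λ f p → f (proj₁ p) (proj₂ p)) (λ f i j → f (i , j))
      (Fin.all? λ i → Fin.all? λ j → S? (i , j))

  J : Set
  J = OrderIdeal _⊑_

  -- A Bool-valued ideal and finite chains make the two conditions decidable, so
  -- the toggleability statistics below really are 0/1-valued functions.
  minimalOutside? : ∀ p (I : J) → Dec (MinimalIn _⊑_ (λ r → ¬ r ∈ I) p)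
  minimalOutside? p I = ¬? (T? (member I p)) ×-dec
    all? (λ r → ¬? (T? (member I r)) →-dec (r ⊑? p →-dec (r ≟ p)))

  maximalInside? : ∀ p (I : J) → Dec (MaximalIn _⊑_ (_∈ I) p)
  maximalInside? p I = T? (member I p) ×-dec
    all? (λ r → T? (member I r) →-dec (p ⊑? r →-dec (r ≟ p)))

  T⁺ T⁻ Tᵠ : [ a ]×[ b ] → J → ℝ⟨q⟩
  T⁺ p I = if does (minimalOutside? p I) then 1ᶠ else 0ᶠ
  T⁻ p I = if does (maximalInside? p I) then 1ᶠ else 0ᶠ
  Tᵠ p I = T⁺ p I -ᶠ q *ᶠ T⁻ p I

  ∑ : ([ a ]×[ b ] → ℝ⟨q⟩) → ℝ⟨q⟩
  ∑ f = sum (λ i → sum (λ j → f (i , j)))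
    where open RawMonoidDefs +ᶠ-rawMonoid using (sum)

  infix 4 _≡ᵠ_

  _≡ᵠ_ : (f g : J → ℝ⟨q⟩) → Set
  f ≡ᵠ g = Σ[ c ∈ ([ a ]×[ b ] → ℝ⟨q⟩) ]
    ∀ I → f I -ᶠ g I ≈ᶠ ∑ (λ p → c p *ᶠ Tᵠ p I)

-- Number the rows and columns from 0 and take c(i , j) = N(i , j) / [a + b]q with
-- N(i , j) = [b]q [i]q + [a]q [j]q - [a]q [b]q.  Then N(a , 0) = N(0 , b) = 0, and
-- [a + b]q + (1 - q) [a]q [b]q = [a]q + [b]q gives
-- N(i + 1 , j + 1) = [a + b]q + q N(i , j), so the claim becomes
--   ∑ N(i + 1 , j + 1) T⁻(i , j) = ∑ N(i , j) T⁺(i , j) + [a]q [b]q.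
-- Let e(i , j) be the indicator that the lattice point (i , j) lies weakly inside
-- the boundary path of I.  Then T⁻(i - 1 , j - 1) - T⁺(i , j) is the second
-- difference e(i , j) - e(i + 1 , j) - e(i , j + 1) + e(i + 1 , j + 1), and since N
-- is a function of i plus a function of j, summation by parts leaves only boundary
-- terms, which do not depend on I.
module Submission where

open import Level using (0ℓ)
open import Algebra.Bundles using (CommutativeRing)
import Algebra.Definitions.RawMonoid as RawMonoidDefinitions
import Algebra.Properties.CommutativeSemigroup as CommutativeSemigroupProperties
import Algebra.Properties.Group as GroupProperties
import Algebra.Properties.Ring as RingProperties
import Algebra.Properties.Semiring.Sum as SemiringSum
import Algebra.Solver.Ring.NaturalCoefficients.Default as SemiringSolver
open import Data.Bool.Base using (if_then_else_)
open import Data.Bool.Properties using (T?)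
open import Data.Fin.Base as Fin using (Fin; toℕ; fromℕ<)
import Data.Fin.Properties as Fin
open import Data.List.Base using ([]; _∷_)
open import Data.Nat.Base as ℕ using (ℕ; zero; suc; _≤_; _<_; z≤n; s≤s)
import Data.Nat.Properties as ℕ
open import Data.Product.Base using (_×_; _,_; proj₁; proj₂)
open import Data.Sum.Base using (inj₁; inj₂)
open import Function.Base using (const)
open import Function.Bundles using (_⇔_; mk⇔)
open import Relation.Binary.Bundles using (Setoid)
import Relation.Binary.PropositionalEquality as ≡
import Relation.Binary.Reasoning.Setoid as ≈-Reasoning
open import Relation.Binary.Structures using (IsEquivalence)
open import Relation.Nullary.Decidable using (Dec; yes; no; does; _×-dec_; _→-dec_; ¬?; dec-true; dec-false; does-⇔; decidable-stable)
open import Relation.Nullary.Negation using (¬_; contradiction)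

open import Defs using (module Polynomial; module FractionField)

-- The commutative ring of polynomials over a commutative ring.

module PolynomialRing (R : CommutativeRing 0ℓ 0ℓ) where
  private
    module R = CommutativeRing R
    module +R = CommutativeSemigroupProperties R.+-commutativeSemigroup
  open R using (Carrier; _≈_; 0#; 1#)
  open Polynomial R

  -- Equality of polynomials is coefficientwise, so coefficient formulas for sums, scalar multiples
  -- and negatives carry the laws of `R` over to lists of any lengths.
  coeff-+ : ∀ f g n → coeff (f +ᴾ g) n ≈ coeff f n R.+ coeff g n
  coeff-+ []      g       n       = R.sym (R.+-identityˡ _)
  coeff-+ (c ∷ f) []      n       = R.sym (R.+-identityʳ _)
  coeff-+ (c ∷ f) (d ∷ g) zero    = R.refl
  coeff-+ (c ∷ f) (d ∷ g) (suc n) = coeff-+ f g n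

  coeff-· : ∀ c g n → coeff (c ·ᴾ g) n ≈ c R.* coeff g n
  coeff-· c []      n       = R.sym (R.zeroʳ c)
  coeff-· c (d ∷ g) zero    = R.refl
  coeff-· c (d ∷ g) (suc n) = coeff-· c g n

  coeff-neg : ∀ f n → coeff (-ᴾ f) n ≈ R.- coeff f n
  coeff-neg []      n       = R.sym (RingProperties.-0#≈0# R.ring)
  coeff-neg (c ∷ f) zero    = R.refl
  coeff-neg (c ∷ f) (suc n) = coeff-neg f n

  ≋-isEquivalence : IsEquivalence _≋_
  ≋-isEquivalence = record
    { refl  = mk≋ λ n → R.refl
    ; sym   = λ e → mk≋ λ n → R.sym (coeff-≈ e n)
    ; trans = λ e e′ → mk≋ λ n → R.trans (coeff-≈ e n) (coeff-≈ e′ n)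
    }

  ≋-setoid : Setoid 0ℓ 0ℓ
  ≋-setoid = record { isEquivalence = ≋-isEquivalence }

  open IsEquivalence ≋-isEquivalence

  ∷-cong : ∀ {c d f g} → c ≈ d → f ≋ g → (c ∷ f) ≋ (d ∷ g)
  ∷-cong c≈d f≋g = mk≋ λ { zero → c≈d ; (suc n) → coeff-≈ f≋g n }

  +-cong : ∀ {f f′ g g′} → f ≋ f′ → g ≋ g′ → f +ᴾ g ≋ f′ +ᴾ g′
  +-cong {f} {f′} {g} {g′} e e′ = mk≋ λ n → R.trans (coeff-+ f g n)
    (R.trans (R.+-cong (coeff-≈ e n) (coeff-≈ e′ n)) (R.sym (coeff-+ f′ g′ n)))

  +-assoc : ∀ f g h → (f +ᴾ g) +ᴾ h ≋ f +ᴾ (g +ᴾ h)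
  +-assoc f g h = mk≋ λ n → begin
    coeff ((f +ᴾ g) +ᴾ h) n                   ≈⟨ coeff-+ (f +ᴾ g) h n ⟩
    coeff (f +ᴾ g) n R.+ coeff h n            ≈⟨ R.+-congʳ (coeff-+ f g n) ⟩
    coeff f n R.+ coeff g n R.+ coeff h n     ≈⟨ R.+-assoc _ _ _ ⟩
    coeff f n R.+ (coeff g n R.+ coeff h n)   ≈⟨ R.+-congˡ (coeff-+ g h n) ⟨
    coeff f n R.+ coeff (g +ᴾ h) n            ≈⟨ coeff-+ f (g +ᴾ h) n ⟨
    coeff (f +ᴾ (g +ᴾ h)) n                   ∎
    where open ≈-Reasoning R.setoid

  +-comm : ∀ f g → f +ᴾ g ≋ g +ᴾ f
  +-comm f g = mk≋ λ n → R.trans (coeff-+ f g n)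
    (R.trans (R.+-comm _ _) (R.sym (coeff-+ g f n)))

  +-identityʳ : ∀ f → f +ᴾ 0ᴾ ≋ f
  +-identityʳ f = mk≋ λ n → R.trans (coeff-+ f 0ᴾ n) (R.+-identityʳ _)

  -‿cong : ∀ {f g} → f ≋ g → -ᴾ f ≋ -ᴾ g
  -‿cong {f} {g} e = mk≋ λ n → R.trans (coeff-neg f n)
    (R.trans (R.-‿cong (coeff-≈ e n)) (R.sym (coeff-neg g n)))

  -‿inverseˡ : ∀ f → -ᴾ f +ᴾ f ≋ 0ᴾ
  -‿inverseˡ f = mk≋ λ n → R.trans (coeff-+ (-ᴾ f) f n)
    (R.trans (R.+-congʳ (coeff-neg f n)) (R.-‿inverseˡ _))

  +-interchange : ∀ f g h k → (f +ᴾ g) +ᴾ (h +ᴾ k) ≋ (f +ᴾ h) +ᴾ (g +ᴾ k)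
  +-interchange f g h k = mk≋ λ n → begin
    coeff ((f +ᴾ g) +ᴾ (h +ᴾ k)) n
      ≈⟨ expand f g h k n ⟩
    (coeff f n R.+ coeff g n) R.+ (coeff h n R.+ coeff k n)
      ≈⟨ +R.interchange _ _ _ _ ⟩
    (coeff f n R.+ coeff h n) R.+ (coeff g n R.+ coeff k n)
      ≈⟨ expand f h g k n ⟨
    coeff ((f +ᴾ h) +ᴾ (g +ᴾ k)) n ∎
    where
    open ≈-Reasoning R.setoid
    expand : ∀ f g h k n → coeff ((f +ᴾ g) +ᴾ (h +ᴾ k)) n ≈
             (coeff f n R.+ coeff g n) R.+ (coeff h n R.+ coeff k n)
    expand f g h k n = R.trans (coeff-+ (f +ᴾ g) (h +ᴾ k) n)
      (R.+-cong (coeff-+ f g n) (coeff-+ h k n))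

  ·-cong : ∀ {c d f g} → c ≈ d → f ≋ g → c ·ᴾ f ≋ d ·ᴾ g
  ·-cong {c} {d} {f} {g} c≈d e = mk≋ λ n → R.trans (coeff-· c f n)
    (R.trans (R.*-cong c≈d (coeff-≈ e n)) (R.sym (coeff-· d g n)))

  ·-distribˡ : ∀ c f g → c ·ᴾ (f +ᴾ g) ≋ c ·ᴾ f +ᴾ c ·ᴾ g
  ·-distribˡ c f g = mk≋ λ n → begin
    coeff (c ·ᴾ (f +ᴾ g)) n                      ≈⟨ coeff-· c (f +ᴾ g) n ⟩
    c R.* coeff (f +ᴾ g) n                       ≈⟨ R.*-congˡ (coeff-+ f g n) ⟩
    c R.* (coeff f n R.+ coeff g n)              ≈⟨ R.distribˡ _ _ _ ⟩
    c R.* coeff f n R.+ c R.* coeff g n          ≈⟨ R.+-cong (coeff-· c f n) (coeff-· c g n) ⟨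
    coeff (c ·ᴾ f) n R.+ coeff (c ·ᴾ g) n        ≈⟨ coeff-+ (c ·ᴾ f) (c ·ᴾ g) n ⟨
    coeff (c ·ᴾ f +ᴾ c ·ᴾ g) n                   ∎
    where open ≈-Reasoning R.setoid

  ·-assoc : ∀ c d f → (c R.* d) ·ᴾ f ≋ c ·ᴾ (d ·ᴾ f)
  ·-assoc c d f = mk≋ λ n → begin
    coeff ((c R.* d) ·ᴾ f) n      ≈⟨ coeff-· (c R.* d) f n ⟩
    c R.* d R.* coeff f n         ≈⟨ R.*-assoc _ _ _ ⟩
    c R.* (d R.* coeff f n)       ≈⟨ R.*-congˡ (coeff-· d f n) ⟨
    c R.* coeff (d ·ᴾ f) n        ≈⟨ coeff-· c (d ·ᴾ f) n ⟨
    coeff (c ·ᴾ (d ·ᴾ f)) n       ∎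
    where open ≈-Reasoning R.setoid

  ·-zeroˡ : ∀ f → 0# ·ᴾ f ≋ 0ᴾ
  ·-zeroˡ f = mk≋ λ n → R.trans (coeff-· 0# f n) (R.zeroˡ _)

  ·-identityˡ : ∀ f → 1# ·ᴾ f ≋ f
  ·-identityˡ f = mk≋ λ n → R.trans (coeff-· 1# f n) (R.*-identityˡ _)

  0∷[]≋0 : (0# ∷ []) ≋ 0ᴾ
  0∷[]≋0 = mk≋ λ { zero → R.refl ; (suc n) → R.refl }

  0∷-distrib-+ : ∀ f g → (0# ∷ (f +ᴾ g)) ≋ (0# ∷ f) +ᴾ (0# ∷ g)
  0∷-distrib-+ f g = ∷-cong (R.sym (R.+-identityˡ 0#)) refl

  ·-0∷ : ∀ c f → c ·ᴾ (0# ∷ f) ≋ (0# ∷ (c ·ᴾ f))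
  ·-0∷ c f = ∷-cong (R.zeroʳ c) refl

  *-zeroʳ : ∀ f → f *ᴾ 0ᴾ ≋ 0ᴾ
  *-zeroʳ []      = refl
  *-zeroʳ (c ∷ f) = trans (∷-cong R.refl (*-zeroʳ f)) 0∷[]≋0

  *-congˡ : ∀ f {g g′} → g ≋ g′ → f *ᴾ g ≋ f *ᴾ g′
  *-congˡ []      e = refl
  *-congˡ (c ∷ f) e = +-cong (·-cong R.refl e) (∷-cong R.refl (*-congˡ f e))

  -- Mirror image of the recursion that defines `_*ᴾ_`; with both recursions at hand, commutativity
  -- is an induction on one factor.
  *-∷ʳ : ∀ f d g → f *ᴾ (d ∷ g) ≋ (d ·ᴾ f) +ᴾ (0# ∷ (f *ᴾ g))
  *-∷ʳ []      d g = sym 0∷[]≋0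
  *-∷ʳ (c ∷ f) d g = ∷-cong (R.+-congʳ (R.*-comm c d)) (begin
    c ·ᴾ g +ᴾ f *ᴾ (d ∷ g)                         ≈⟨ +-cong refl (*-∷ʳ f d g) ⟩
    c ·ᴾ g +ᴾ (d ·ᴾ f +ᴾ (0# ∷ (f *ᴾ g)))          ≈⟨ +-assoc (c ·ᴾ g) (d ·ᴾ f) _ ⟨
    (c ·ᴾ g +ᴾ d ·ᴾ f) +ᴾ (0# ∷ (f *ᴾ g))          ≈⟨ +-cong (+-comm (c ·ᴾ g) (d ·ᴾ f)) refl ⟩
    (d ·ᴾ f +ᴾ c ·ᴾ g) +ᴾ (0# ∷ (f *ᴾ g))          ≈⟨ +-assoc (d ·ᴾ f) (c ·ᴾ g) _ ⟩
    d ·ᴾ f +ᴾ (c ·ᴾ g +ᴾ (0# ∷ (f *ᴾ g)))          ∎)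
    where open ≈-Reasoning ≋-setoid

  *-comm : ∀ f g → f *ᴾ g ≋ g *ᴾ f
  *-comm []      g = sym (*-zeroʳ g)
  *-comm (c ∷ f) g = trans (+-cong refl (∷-cong R.refl (*-comm f g))) (sym (*-∷ʳ g c f))

  *-distribˡ-+ : ∀ f g h → f *ᴾ (g +ᴾ h) ≋ f *ᴾ g +ᴾ f *ᴾ h
  *-distribˡ-+ []      g h = refl
  *-distribˡ-+ (c ∷ f) g h = trans
    (+-cong (·-distribˡ c g h)
      (trans (∷-cong R.refl (*-distribˡ-+ f g h)) (0∷-distrib-+ (f *ᴾ g) (f *ᴾ h))))
    (+-interchange (c ·ᴾ g) (c ·ᴾ h) _ _)

  *-distribʳ-+ : ∀ h f g → (f +ᴾ g) *ᴾ h ≋ f *ᴾ h +ᴾ g *ᴾ h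
  *-distribʳ-+ h f g = trans (*-comm (f +ᴾ g) h)
    (trans (*-distribˡ-+ h f g) (+-cong (*-comm h f) (*-comm h g)))

  ·-*-assoc : ∀ c f g → (c ·ᴾ f) *ᴾ g ≋ c ·ᴾ (f *ᴾ g)
  ·-*-assoc c []      g = refl
  ·-*-assoc c (d ∷ f) g = trans
    (+-cong (·-assoc c d g) (trans (∷-cong R.refl (·-*-assoc c f g)) (sym (·-0∷ c (f *ᴾ g)))))
    (sym (·-distribˡ c (d ·ᴾ g) _))

  0∷-* : ∀ f g → (0# ∷ f) *ᴾ g ≋ (0# ∷ (f *ᴾ g))
  0∷-* f g = +-cong (·-zeroˡ g) refl

  *-assoc : ∀ f g h → (f *ᴾ g) *ᴾ h ≋ f *ᴾ (g *ᴾ h)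
  *-assoc []      g h = refl
  *-assoc (c ∷ f) g h = trans (*-distribʳ-+ h (c ·ᴾ g) _)
    (+-cong (·-*-assoc c g h) (trans (0∷-* (f *ᴾ g) h) (∷-cong R.refl (*-assoc f g h))))

  *-identityˡ : ∀ f → 1ᴾ *ᴾ f ≋ f
  *-identityˡ f = trans (+-cong (·-identityˡ f) 0∷[]≋0) (+-identityʳ f)

  X-* : ∀ f → X *ᴾ f ≋ (0# ∷ f)
  X-* f = trans (0∷-* 1ᴾ f) (∷-cong R.refl (*-identityˡ f))

  -- The Horner step. For lists of ones it becomes the recursion `[suc]q` of the q-integers.
  ∷-as-sum : ∀ c f → (c ∷ f) ≋ (c ∷ []) +ᴾ X *ᴾ f
  ∷-as-sum c f = sym (trans (+-cong {c ∷ []} refl (X-* f)) (∷-cong (R.+-identityʳ c) refl))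

  commutativeRing : CommutativeRing 0ℓ 0ℓ
  commutativeRing = record
    { Carrier = Poly
    ; _≈_ = _≋_
    ; _+_ = _+ᴾ_
    ; _*_ = _*ᴾ_
    ; -_ = -ᴾ_
    ; 0# = 0ᴾ
    ; 1# = 1ᴾ
    ; isCommutativeRing = record
      { isRing = record
        { +-isAbelianGroup = record
          { isGroup = record
            { isMonoid = record
              { isSemigroup = record
                { isMagma = record { isEquivalence = ≋-isEquivalence ; ∙-cong = +-cong }
                ; assoc = +-assoc
                }
              ; identity = (λ f → refl) , +-identityʳ
              }
            ; inverse = -‿inverseˡ , (λ f → trans (+-comm f (-ᴾ f)) (-‿inverseˡ f))
            ; ⁻¹-cong = -‿cong
            }
          ; comm = +-comm
          }
        -- Equal left factors may be lists of different lengths, which blocks an induction on them;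
        -- commutativity moves the change to the right factor, where `*-congˡ` applies.
        ; *-cong = λ {f} {f′} {g} {g′} e e′ → trans (*-congˡ f e′)
            (trans (*-comm f g′) (trans (*-congˡ g′ e) (*-comm g′ f′)))
        ; *-assoc = *-assoc
        ; *-identity = *-identityˡ , (λ f → trans (*-comm f 1ᴾ) (*-identityˡ f))
        ; distrib = *-distribˡ-+ , *-distribʳ-+
        }
      ; *-comm = *-comm
      }
    }

-- Staircases and their corners.

-- The lattice points (i , j) with 0 ≤ i ≤ a and 0 ≤ j ≤ b that lie weakly
-- inside the boundary path of an order ideal of [a] × [b].
record Staircase (a b : ℕ) : Set₁ where
  field
    E       : ℕ → ℕ → Set
    E?      : ∀ i j → Dec (E i j)
    pred₁   : ∀ {i j} → E (suc i) j → E i j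
    pred₂   : ∀ {i j} → E i (suc j) → E i j
    bound₁  : ∀ {i j} → E i j → i ≤ a
    bound₂  : ∀ {i j} → E i j → j ≤ b
    axis₁   : ∀ {i} → i ≤ a → E i 0
    axis₂   : ∀ {j} → j ≤ b → E 0 j

  -- With coordinates from 0, a poset element (x , y) is the unit cell between the points (x , y)
  -- and (x + 1 , y + 1). It is maximal in the ideal when the latter is an outer corner, and minimal
  -- outside it when the former is an inner corner.
  OuterCorner InnerCorner : ℕ → ℕ → Set
  OuterCorner i j = E i j × ¬ E (suc i) j × ¬ E i (suc j)
  InnerCorner i j = ¬ E (suc i) (suc j) × E i (suc j) × E (suc i) j

  outerCorner? : ∀ i j → Dec (OuterCorner i j)
  outerCorner? i j = E? i j ×-dec ¬? (E? (suc i) j) ×-dec ¬? (E? i (suc j))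

  innerCorner? : ∀ i j → Dec (InnerCorner i j)
  innerCorner? i j = ¬? (E? (suc i) (suc j)) ×-dec E? i (suc j) ×-dec E? (suc i) j

-- Finite double sums and summation by parts.

module Sums (S : CommutativeRing 0ℓ 0ℓ) where
  open CommutativeRing S
  open SemiringSum semiring using (sum; sum-cong-≋; ∑-distrib-+; ∑-comm; *-distribˡ-sum)
  open SemiringSolver commutativeSemiring using (solve; _:+_; _:*_; _:=_; con)
  open ≈-Reasoning setoid

  -- Opaque so that unification can read f off ∑< (suc n) f.
  opaque
    ∑< : ℕ → (ℕ → Carrier) → Carrier
    ∑< n f = sum {n} (λ i → f (toℕ i))

    ∑<-cong : ∀ n {f g : ℕ → Carrier} → (∀ {i} → i < n → f i ≈ g i) → ∑< n f ≈ ∑< n g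
    ∑<-cong n e = sum-cong-≋ (λ i → e (Fin.toℕ<n i))

    ∑<-+ : ∀ n (f g : ℕ → Carrier) → ∑< n (λ i → f i + g i) ≈ ∑< n f + ∑< n g
    ∑<-+ n f g = ∑-distrib-+ {n} (λ i → f (toℕ i)) (λ i → g (toℕ i))

    ∑<-last : ∀ n (f : ℕ → Carrier) → ∑< (suc n) f ≈ ∑< n f + f n
    ∑<-last zero    f = +-comm (f 0) 0#
    ∑<-last (suc n) f = trans (+-congˡ (∑<-last n (λ i → f (suc i)))) (sym (+-assoc _ _ _))

    ∑<-zero : ∀ n {f : ℕ → Carrier} → (∀ {i} → i < n → f i ≈ 0#) → ∑< n f ≈ 0#
    ∑<-zero zero    e = refl
    ∑<-zero (suc n) e = trans (+-cong (e (s≤s z≤n)) (∑<-zero n (λ i<n → e (s≤s i<n)))) (+-identityˡ 0#)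

    ∑<-first : ∀ n (f : ℕ → Carrier) → ∑< (suc n) f ≈ f 0 + ∑< n (λ i → f (suc i))
    ∑<-first n f = refl

    *-distribˡ-∑< : ∀ n x (f : ℕ → Carrier) → x * ∑< n f ≈ ∑< n (λ i → x * f i)
    *-distribˡ-∑< n x f = *-distribˡ-sum {n} x (λ i → f (toℕ i))

    ∑∑-comm : ∀ m n (F : ℕ → ℕ → Carrier) →
              ∑< m (λ i → ∑< n (λ j → F i j)) ≈ ∑< n (λ j → ∑< m (λ i → F i j))
    ∑∑-comm m n F = ∑-comm {m} {n} (λ i j → F (toℕ i) (toℕ j))

  ∑∑ : ℕ → ℕ → (ℕ → ℕ → Carrier) → Carrier
  ∑∑ m n F = ∑< m λ i → ∑< n λ j → F i j

  ∑∑-cong : ∀ m n {F G : ℕ → ℕ → Carrier} → (∀ {i j} → i < m → j < n → F i j ≈ G i j) →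
            ∑∑ m n F ≈ ∑∑ m n G
  ∑∑-cong m n e = ∑<-cong m λ i<m → ∑<-cong n λ j<n → e i<m j<n

  ∑∑-+ : ∀ m n (F G : ℕ → ℕ → Carrier) → ∑∑ m n (λ i j → F i j + G i j) ≈ ∑∑ m n F + ∑∑ m n G
  ∑∑-+ m n F G = trans (∑<-cong m λ {i} _ → ∑<-+ n (F i) (G i)) (∑<-+ m _ _)

  -- Summation by parts in the first index, with both sides moved to avoid
  -- subtraction.
  weighted-difference : ∀ a n (f : ℕ → Carrier) (u : ℕ → ℕ → Carrier) →
    (∀ i → u i n ≈ 0#) → (∀ {i} → i ≤ a → u i 0 ≈ 1#) → u (suc a) 0 ≈ 0# →
    ∑∑ (suc a) n (λ i j → f i * (u (suc i) j + u i (suc j))) + f a ≈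
    ∑∑ (suc a) n (λ i j → f i * (u i j + u (suc i) (suc j)))
  weighted-difference a n f u u-n u-0 u-a = begin
    ∑∑ (suc a) n l + f a
      ≈⟨ +-congʳ (∑<-last a (λ i → ∑< n (l i))) ⟩
    ∑∑ a n l + ∑< n (l a) + f a
      ≈⟨ +-assoc _ _ _ ⟩
    ∑∑ a n l + (∑< n (l a) + f a)
      ≈⟨ +-cong (∑<-cong a λ i<a → trans (row-l _) (trans (*-congˡ (middle i<a)) (sym (row-r _)))) end ⟩
    ∑∑ a n r + ∑< n (r a)
      ≈⟨ ∑<-last a (λ i → ∑< n (r i)) ⟨
    ∑∑ (suc a) n r ∎
    where
    l r : ℕ → ℕ → Carrier
    l i j = f i * (u (suc i) j + u i (suc j))
    r i j = f i * (u i j + u (suc i) (suc j))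

    U V : ℕ → Carrier
    U i = ∑< n (u i)
    V i = ∑< n (λ j → u i (suc j))

    -- Since `u i n` vanishes, shifting a row by one place loses only its first entry.
    U≈ : ∀ i → U i ≈ u i 0 + V i
    U≈ i = begin
      U i             ≈⟨ +-identityʳ _ ⟨
      U i + 0#        ≈⟨ +-congˡ (u-n i) ⟨
      U i + u i n     ≈⟨ ∑<-last n (u i) ⟨
      ∑< (suc n) (u i) ≈⟨ ∑<-first n (u i) ⟩
      u i 0 + V i     ∎

    row-l : ∀ i → ∑< n (l i) ≈ f i * (U (suc i) + V i)
    row-l i = trans (sym (*-distribˡ-∑< n (f i) _)) (*-congˡ (∑<-+ n (u (suc i)) (λ j → u i (suc j))))

    row-r : ∀ i → ∑< n (r i) ≈ f i * (U i + V (suc i))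
    row-r i = trans (sym (*-distribˡ-∑< n (f i) _)) (*-congˡ (∑<-+ n (u i) (λ j → u (suc i) (suc j))))

    -- Rows `i` and `suc i` both start with 1, so the shift costs the same on both sides.
    middle : ∀ {i} → i < a → U (suc i) + V i ≈ U i + V (suc i)
    middle {i} i<a = begin
      U (suc i) + V i          ≈⟨ +-congʳ (trans (U≈ (suc i)) (+-congʳ (u-0 i<a))) ⟩
      1# + V (suc i) + V i     ≈⟨ solve 2 (λ x y → con 1 :+ x :+ y := con 1 :+ y :+ x) refl (V (suc i)) (V i) ⟩
      1# + V i + V (suc i)     ≈⟨ +-congʳ (trans (U≈ i) (+-congʳ (u-0 (ℕ.<⇒≤ i<a)))) ⟨
      U i + V (suc i)          ∎

    -- Row `suc a` starts with 0 while row `a` starts with 1; the missing 1 is the source of the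
    -- boundary term `f a`.
    end : ∑< n (l a) + f a ≈ ∑< n (r a)
    end = begin
      ∑< n (l a) + f a
        ≈⟨ +-congʳ (trans (row-l a) (*-congˡ (+-congʳ (trans (U≈ (suc a)) (+-congʳ u-a))))) ⟩
      f a * (0# + V (suc a) + V a) + f a
        ≈⟨ solve 3 (λ f x y → f :* (con 0 :+ x :+ y) :+ f := f :* (con 1 :+ y :+ x)) refl (f a) (V (suc a)) (V a) ⟩
      f a * (1# + V a + V (suc a))
        ≈⟨ trans (row-r a) (*-congˡ (+-congʳ (trans (U≈ a) (+-congʳ (u-0 ℕ.≤-refl))))) ⟨
      ∑< n (r a) ∎

  -- Indicators and weighted corner sums.

  χ : ∀ {A : Set} → Dec A → Carrier
  χ A? = if does A? then 1# else 0#

  χ-yes : ∀ {A : Set} (A? : Dec A) → A → χ A? ≈ 1#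
  χ-yes A? x = reflexive (≡.cong (if_then 1# else 0#) (dec-true A? x))

  χ-no : ∀ {A : Set} (A? : Dec A) → ¬ A → χ A? ≈ 0#
  χ-no A? ¬x = reflexive (≡.cong (if_then 1# else 0#) (dec-false A? ¬x))

  -- For 0/1 values e₀₀ ≥ e₁₀, e₀₁ ≥ e₁₁ this says e₀₀ - e₁₀ - e₀₁ + e₁₁ is
  -- [only e₀₀] - [all but e₁₁], with both sides moved to avoid subtraction.
  second-difference : ∀ {A B C D : Set} (a : Dec A) (b : Dec B) (c : Dec C) (d : Dec D) →
    (B → A) → (C → A) → (D → B) → (D → C) →
    χ (a ×-dec ¬? b ×-dec ¬? c) + (χ b + χ c) ≈ (χ a + χ d) + χ (¬? d ×-dec c ×-dec b)
  second-difference (yes _) (yes _) (yes _) (yes _) _ _ _ _ =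
    solve 0 (con 0 :+ (con 1 :+ con 1) := (con 1 :+ con 1) :+ con 0) refl
  second-difference (yes _) (yes _) (yes _) (no _)  _ _ _ _ =
    solve 0 (con 0 :+ (con 1 :+ con 1) := (con 1 :+ con 0) :+ con 1) refl
  second-difference (yes _) (yes _) (no _)  (no _)  _ _ _ _ =
    solve 0 (con 0 :+ (con 1 :+ con 0) := (con 1 :+ con 0) :+ con 0) refl
  second-difference (yes _) (no _)  (yes _) (no _)  _ _ _ _ =
    solve 0 (con 0 :+ (con 0 :+ con 1) := (con 1 :+ con 0) :+ con 0) refl
  second-difference (yes _) (no _)  (no _)  (no _)  _ _ _ _ =
    solve 0 (con 1 :+ (con 0 :+ con 0) := (con 1 :+ con 0) :+ con 0) refl
  second-difference (no _)  (no _)  (no _)  (no _)  _ _ _ _ =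
    solve 0 (con 0 :+ (con 0 :+ con 0) := (con 0 :+ con 0) :+ con 0) refl
  second-difference (no ¬a) (yes b) _       _       ba _ _ _ = contradiction (ba b) ¬a
  second-difference (no ¬a) _       (yes c) _       _ ca _ _ = contradiction (ca c) ¬a
  second-difference _       (no ¬b) _       (yes d) _ _ db _ = contradiction (db d) ¬b
  second-difference _       _       (no ¬c) (yes d) _ _ _ dc = contradiction (dc d) ¬c

  module _ {a b : ℕ} (σ : Staircase a b) where
    open Staircase σ

    private
      u : ℕ → ℕ → Carrier
      u i j = χ (E? i j)

      A B : ℕ → ℕ → Carrier
      A i j = χ (outerCorner? i j)
      B i j = χ (innerCorner? i j)

    -- Weight `second-difference` by `f i + g j` and sum. By `weighted-difference` the `f` part
    -- leaves `f a` and, with the indices exchanged, the `g` part leaves `g b`. Adding `Lf + Lg` to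
    -- both sides and cancelling it at the end keeps the identities free of subtraction.
    corner-sum : (f g : ℕ → Carrier) →
      ∑∑ (suc a) (suc b) (λ i j → (f i + g j) * A i j) ≈
      ∑∑ (suc a) (suc b) (λ i j → (f i + g j) * B i j) + (f a + g b)
    corner-sum f g = +-cancelʳ (Lf + Lg) _ _ (begin
      NA + (Lf + Lg)
        ≈⟨ trans (∑∑-+ m n _ _) (+-congˡ (∑∑-+ m n _ _)) ⟨
      ∑∑ m n (λ i j → (f i + g j) * A i j + (f i * l i j + g j * l i j))
        ≈⟨ ∑∑-cong m n (λ {i} {j} _ _ → local i j) ⟩
      ∑∑ m n (λ i j → (f i + g j) * B i j + (f i * r i j + g j * r i j))
        ≈⟨ trans (∑∑-+ m n _ _) (+-congˡ (∑∑-+ m n _ _)) ⟩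
      NB + (Rf + Rg)
        ≈⟨ +-congˡ (+-cong Lf+fa Lg+gb) ⟨
      NB + ((Lf + f a) + (Lg + g b))
        ≈⟨ solve 5 (λ x y z v w → x :+ ((y :+ z) :+ (v :+ w)) := (x :+ (z :+ w)) :+ (y :+ v))
             refl NB Lf (f a) Lg (g b) ⟩
      NB + (f a + g b) + (Lf + Lg) ∎)
      where
      open GroupProperties +-group using () renaming (∙-cancelʳ to +-cancelʳ)
      m = suc a
      n = suc b
      l r : ℕ → ℕ → Carrier
      l i j = u (suc i) j + u i (suc j)
      r i j = u i j + u (suc i) (suc j)
      NA = ∑∑ m n (λ i j → (f i + g j) * A i j)
      NB = ∑∑ m n (λ i j → (f i + g j) * B i j)
      Lf = ∑∑ m n (λ i j → f i * l i j)
      Lg = ∑∑ m n (λ i j → g j * l i j)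
      Rf = ∑∑ m n (λ i j → f i * r i j)
      Rg = ∑∑ m n (λ i j → g j * r i j)

      local : ∀ i j → (f i + g j) * A i j + (f i * l i j + g j * l i j) ≈
                      (f i + g j) * B i j + (f i * r i j + g j * r i j)
      local i j = begin
        (f i + g j) * A i j + (f i * l i j + g j * l i j)
          ≈⟨ solve 4 (λ f g x y → (f :+ g) :* x :+ (f :* y :+ g :* y) := (f :+ g) :* (x :+ y))
               refl (f i) (g j) (A i j) (l i j) ⟩
        (f i + g j) * (A i j + l i j)
          ≈⟨ *-congˡ (second-difference (E? i j) (E? (suc i) j) (E? i (suc j)) (E? (suc i) (suc j))
               pred₁ pred₂ pred₂ pred₁) ⟩
        (f i + g j) * (r i j + B i j)
          ≈⟨ solve 4 (λ f g x y → (f :+ g) :* (y :+ x) := (f :+ g) :* x :+ (f :* y :+ g :* y))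
               refl (f i) (g j) (B i j) (r i j) ⟩
        (f i + g j) * B i j + (f i * r i j + g j * r i j) ∎

      Lf+fa : Lf + f a ≈ Rf
      Lf+fa = weighted-difference a n f u
        (λ i → χ-no (E? i n) (λ e → ℕ.<-irrefl ≡.refl (bound₂ e)))
        (λ i≤a → χ-yes (E? _ 0) (axis₁ i≤a))
        (χ-no (E? m 0) (λ e → ℕ.<-irrefl ≡.refl (bound₁ e)))

      Lg+gb : Lg + g b ≈ Rg
      Lg+gb = begin
        Lg + g b
          ≈⟨ +-congʳ (trans (∑∑-comm m n _) (∑∑-cong n m λ _ _ → *-congˡ (+-comm _ _))) ⟩
        ∑∑ n m (λ j i → g j * (u i (suc j) + u (suc i) j)) + g b
          ≈⟨ weighted-difference b m g (λ j i → u i j)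
               (λ j → χ-no (E? m j) (λ e → ℕ.<-irrefl ≡.refl (bound₁ e)))
               (λ j≤b → χ-yes (E? 0 _) (axis₂ j≤b))
               (χ-no (E? 0 n) (λ e → ℕ.<-irrefl ≡.refl (bound₂ e))) ⟩
        ∑∑ n m (λ j i → g j * (u i j + u (suc i) (suc j)))
          ≈⟨ ∑∑-comm m n _ ⟨
        Rg ∎

    -- The weights vanish at the two ends (a , 0) and (0 , b) of the boundary path,
    -- so the corners on the axes contribute nothing.
    box-corner-sum : (f g : ℕ → Carrier) → f a + g 0 ≈ 0# → f 0 + g b ≈ 0# →
      ∑∑ a b (λ i j → (f (suc i) + g (suc j)) * A (suc i) (suc j)) ≈
      ∑∑ a b (λ i j → (f i + g j) * B i j) + (f a + g b)
    box-corner-sum f g fa+g0≈0 f0+gb≈0 = begin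
      ∑∑ a b (λ i j → NA (suc i) (suc j))
        ≈⟨ ∑<-cong a (λ i<a → trans (∑<-first b _) (trans (+-congʳ (first-column (s≤s i<a))) (+-identityˡ _))) ⟨
      ∑< a (λ i → ∑< (suc b) (NA (suc i)))
        ≈⟨ trans (∑<-first a _) (trans (+-congʳ (∑<-zero (suc b) first-row)) (+-identityˡ _)) ⟨
      ∑∑ (suc a) (suc b) NA
        ≈⟨ corner-sum f g ⟩
      ∑∑ (suc a) (suc b) NB + (f a + g b)
        ≈⟨ +-congʳ (trans (∑<-last a _) (trans (+-congˡ (∑<-zero (suc b) λ _ → last-row)) (+-identityʳ _))) ⟩
      ∑< a (λ i → ∑< (suc b) (NB i)) + (f a + g b)
        ≈⟨ +-congʳ (∑<-cong a λ _ → trans (∑<-last b _) (trans (+-congˡ last-column) (+-identityʳ _))) ⟩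
      ∑∑ a b NB + (f a + g b) ∎
      where
      NA NB : ℕ → ℕ → Carrier
      NA i j = (f i + g j) * A i j
      NB i j = (f i + g j) * B i j

      -- All axis points are inside, so on each axis only the far end can be an outer corner, and
      -- the weight is zero there.
      first-row : ∀ {j} → j < suc b → NA 0 j ≈ 0#
      first-row {j} (s≤s j≤b) with ℕ.m≤n⇒m<n∨m≡n j≤b
      ... | inj₁ j<b    = trans (*-congˡ (χ-no (outerCorner? 0 j) λ (_ , _ , ¬e) → ¬e (axis₂ j<b))) (zeroʳ _)
      ... | inj₂ ≡.refl = trans (*-congʳ f0+gb≈0) (zeroˡ _)

      first-column : ∀ {i} → i < suc a → NA i 0 ≈ 0#
      first-column {i} (s≤s i≤a) with ℕ.m≤n⇒m<n∨m≡n i≤a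
      ... | inj₁ i<a    = trans (*-congˡ (χ-no (outerCorner? i 0) λ (_ , ¬e , _) → ¬e (axis₁ i<a))) (zeroʳ _)
      ... | inj₂ ≡.refl = trans (*-congʳ fa+g0≈0) (zeroˡ _)

      -- An inner corner in row `a` or column `b` would require a point beyond the rectangle to be
      -- inside.
      last-row : ∀ {j} → NB a j ≈ 0#
      last-row {j} = trans (*-congˡ (χ-no (innerCorner? a j)
        λ (_ , _ , e) → ℕ.<-irrefl ≡.refl (bound₁ e))) (zeroʳ _)

      last-column : ∀ {i} → NB i b ≈ 0#
      last-column {i} = trans (*-congˡ (χ-no (innerCorner? i b)
        λ (_ , e , _) → ℕ.<-irrefl ≡.refl (bound₂ e))) (zeroʳ _)

  -- q-integers, given by their recursion, and the toggle weights.

  module _ (q : Carrier) (h : ℕ → Carrier) (h-zero : h 0 ≈ 0#)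
           (h-suc : ∀ m → h (suc m) ≈ 1# + q * h m) where

    -- Induction on `a`: after one use of the recursion, the left side is `1# + h b` plus `q` times
    -- the left side for the smaller `a`. All terms carry a plus sign so that the semiring solver
    -- applies.
    h-+ : ∀ a b → h (a ℕ.+ b) + h a * h b ≈ h a + h b + q * (h a * h b)
    h-+ zero b = begin
      h b + h 0 * h b                 ≈⟨ +-congˡ (*-congʳ h-zero) ⟩
      h b + 0# * h b
        ≈⟨ solve 2 (λ q x → x :+ con 0 :* x := con 0 :+ x :+ q :* (con 0 :* x)) refl q (h b) ⟩
      0# + h b + q * (0# * h b)
        ≈⟨ +-cong (+-congʳ h-zero) (*-congˡ (*-congʳ h-zero)) ⟨
      h 0 + h b + q * (h 0 * h b)     ∎
    h-+ (suc a) b = begin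
      h (suc a ℕ.+ b) + h (suc a) * h b
        ≈⟨ +-cong (h-suc (a ℕ.+ b)) (*-congʳ (h-suc a)) ⟩
      1# + q * h (a ℕ.+ b) + (1# + q * h a) * h b
        ≈⟨ solve 4 (λ q s x y → con 1 :+ q :* s :+ (con 1 :+ q :* x) :* y :=
                               con 1 :+ y :+ q :* (s :+ x :* y)) refl q (h (a ℕ.+ b)) (h a) (h b) ⟩
      1# + h b + q * (h (a ℕ.+ b) + h a * h b)
        ≈⟨ +-congˡ (*-congˡ (h-+ a b)) ⟩
      1# + h b + q * (h a + h b + q * (h a * h b))
        ≈⟨ solve 3 (λ q x y → con 1 :+ y :+ q :* (x :+ y :+ q :* (x :* y)) :=
                             con 1 :+ q :* x :+ y :+ q :* ((con 1 :+ q :* x) :* y)) refl q (h a) (h b) ⟩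
      1# + q * h a + h b + q * ((1# + q * h a) * h b)
        ≈⟨ +-cong (+-congʳ (h-suc a)) (*-congˡ (*-congʳ (h-suc a))) ⟨
      h (suc a) + h b + q * (h (suc a) * h b) ∎

    module _ (a b : ℕ) where
      private
        -- With the constant placed in `g`, both `f 0` and `g b` vanish, and the boundary term
        -- `f a + g b` is `h a * h b`.
        f g : ℕ → Carrier
        f i = h b * h i
        g j = h a * h j + - (h a * h b)

      weight : ℕ → ℕ → Carrier
      weight i j = f i + g j

      weight-suc : ∀ i j → weight (suc i) (suc j) ≈ h (a ℕ.+ b) + q * weight i j
      weight-suc i j = begin
        h b * h (suc i) + (h a * h (suc j) + n)
          ≈⟨ +-cong (*-congˡ (h-suc i)) (+-congʳ (*-congˡ (h-suc j))) ⟩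
        h b * (1# + q * h i) + (h a * (1# + q * h j) + n)
          -- The summand `q * 0#` is a placeholder for `q * (h a * h b + n)`, which supplies the
          -- product term on the right of `h-+`. To the semiring solver `n` is just a variable, so
          -- it is cancelled by hand.
          ≈⟨ solve 6 (λ q x y u v n → y :* (con 1 :+ q :* u) :+ (x :* (con 1 :+ q :* v) :+ n) :=
               x :+ y :+ q :* con 0 :+ (n :+ q :* (y :* u :+ x :* v))) refl q (h a) (h b) (h i) (h j) n ⟩
        h a + h b + q * 0# + (n + q * (h b * h i + h a * h j))
          ≈⟨ +-congʳ (+-congˡ (*-congˡ (-‿inverseʳ (h a * h b)))) ⟨
        h a + h b + q * (h a * h b + n) + (n + q * (h b * h i + h a * h j))
          ≈⟨ solve 5 (λ q p x n z → x :+ q :* (p :+ n) :+ (n :+ q :* z) :=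
               x :+ q :* p :+ (n :+ q :* (n :+ z))) refl q (h a * h b) (h a + h b) n (h b * h i + h a * h j) ⟩
        h a + h b + q * (h a * h b) + (n + q * (n + (h b * h i + h a * h j)))
          ≈⟨ +-congʳ (h-+ a b) ⟨
        h (a ℕ.+ b) + h a * h b + (n + q * (n + (h b * h i + h a * h j)))
          ≈⟨ solve 6 (λ q d p n u v → d :+ p :+ (n :+ q :* (n :+ (u :+ v))) :=
               d :+ (p :+ n) :+ q :* (u :+ (v :+ n))) refl q (h (a ℕ.+ b)) (h a * h b) n (h b * h i) (h a * h j) ⟩
        h (a ℕ.+ b) + (h a * h b + n) + q * (h b * h i + (h a * h j + n))
          ≈⟨ +-congʳ (trans (+-congˡ (-‿inverseʳ (h a * h b))) (+-identityʳ _)) ⟩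
        h (a ℕ.+ b) + q * (h b * h i + (h a * h j + n)) ∎
        where n = - (h a * h b)

      module _ (σ : Staircase a b) where
        open Staircase σ

        private
          A B : ℕ → ℕ → Carrier
          A i j = χ (outerCorner? (suc i) (suc j))
          B i j = χ (innerCorner? i j)

        -- This is the theorem with the denominator `h (a + b)` cleared. Adding `NA` cancels the `q`
        -- terms by `weight-suc` and leaves `NB` plus `h (a + b)` times the sum of `A`. As `NA`
        -- equals `NB + h a * h b` by `box-corner-sum`, cancelling `NB` finishes.
        weighted-toggle-sum :
          ∑∑ a b (λ i j → weight i j * (B i j + - (q * A i j))) ≈
          ∑∑ a b A * h (a ℕ.+ b) + - (h a * h b)
        weighted-toggle-sum = begin
          W
            ≈⟨ trans (+-congˡ (-‿inverseʳ p)) (+-identityʳ W) ⟨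
          W + (p + - p)
            ≈⟨ +-assoc W p (- p) ⟨
          W + p + - p
            ≈⟨ +-congʳ (∙-cancelʳ NB _ _ W+p+NB) ⟩
          ∑∑ a b A * d + - p ∎
          where
          open GroupProperties +-group using (∙-cancelʳ)
          p = h a * h b
          d = h (a ℕ.+ b)
          W = ∑∑ a b (λ i j → weight i j * (B i j + - (q * A i j)))
          NB = ∑∑ a b (λ i j → weight i j * B i j)
          NA = ∑∑ a b (λ i j → weight (suc i) (suc j) * A i j)

          fa+g0 : f a + g 0 ≈ 0#
          fa+g0 = begin
            h b * h a + (h a * h 0 + - p)   ≈⟨ +-congˡ (+-congʳ (*-congˡ h-zero)) ⟩
            h b * h a + (h a * 0# + - p)
              ≈⟨ solve 3 (λ x y n → y :* x :+ (x :* con 0 :+ n) := x :* y :+ n) refl (h a) (h b) (- p) ⟩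
            p + - p                         ≈⟨ -‿inverseʳ p ⟩
            0#                              ∎

          f0+gb : f 0 + g b ≈ 0#
          f0+gb = begin
            h b * h 0 + (p + - p)  ≈⟨ +-cong (*-congˡ h-zero) (-‿inverseʳ p) ⟩
            h b * 0# + 0#          ≈⟨ +-identityʳ _ ⟩
            h b * 0#               ≈⟨ zeroʳ (h b) ⟩
            0#                     ∎

          fa+gb : f a + g b ≈ p
          fa+gb = trans (+-cong (*-comm (h b) (h a)) (-‿inverseʳ p)) (+-identityʳ p)

          local : ∀ i j → weight i j * (B i j + - (q * A i j)) + weight (suc i) (suc j) * A i j ≈
                          weight i j * B i j + d * A i j
          local i j = begin
            w * (B i j + n) + weight (suc i) (suc j) * A i j
              ≈⟨ +-congˡ (*-congʳ (weight-suc i j)) ⟩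
            w * (B i j + n) + (d + q * w) * A i j
              ≈⟨ solve 6 (λ q w d x y n → w :* (y :+ n) :+ (d :+ q :* w) :* x :=
                   w :* y :+ d :* x :+ w :* (q :* x :+ n)) refl q w d (A i j) (B i j) n ⟩
            w * B i j + d * A i j + w * (q * A i j + n)
              ≈⟨ +-congˡ (trans (*-congˡ (-‿inverseʳ (q * A i j))) (zeroʳ w)) ⟩
            w * B i j + d * A i j + 0#
              ≈⟨ +-identityʳ _ ⟩
            w * B i j + d * A i j ∎
            where
            w = weight i j
            n = - (q * A i j)

          W+p+NB : W + p + NB ≈ ∑∑ a b A * d + NB
          W+p+NB = begin
            W + p + NB
              ≈⟨ solve 3 (λ x y z → x :+ y :+ z := x :+ (z :+ y)) refl W p NB ⟩
            W + (NB + p)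
              ≈⟨ +-congˡ (+-congˡ fa+gb) ⟨
            W + (NB + (f a + g b))
              ≈⟨ +-congˡ (box-corner-sum σ f g fa+g0 f0+gb) ⟨
            W + NA
              ≈⟨ ∑∑-+ a b _ _ ⟨
            ∑∑ a b (λ i j → weight i j * (B i j + - (q * A i j)) + weight (suc i) (suc j) * A i j)
              ≈⟨ ∑∑-cong a b (λ {i} {j} _ _ → local i j) ⟩
            ∑∑ a b (λ i j → weight i j * B i j + d * A i j)
              ≈⟨ ∑∑-+ a b _ _ ⟩
            NB + ∑∑ a b (λ i j → d * A i j)
              ≈⟨ +-congˡ (trans (∑<-cong a λ _ → sym (*-distribˡ-∑< b d _)) (sym (*-distribˡ-∑< a d _))) ⟩
            NB + d * ∑∑ a b A
              ≈⟨ solve 3 (λ x y z → x :+ y :* z := z :* y :+ x) refl NB d (∑∑ a b A) ⟩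
            ∑∑ a b A * d + NB ∎

-- Transfer between fractions and ring elements.

module Fractions (S : CommutativeRing 0ℓ 0ℓ)
  (1≉0 : ¬ CommutativeRing._≈_ S (CommutativeRing.1# S) (CommutativeRing.0# S))
  (*-≉0 : ∀ x y → ¬ CommutativeRing._≈_ S x (CommutativeRing.0# S) →
          ¬ CommutativeRing._≈_ S y (CommutativeRing.0# S) →
          ¬ CommutativeRing._≈_ S (CommutativeRing._*_ S x y) (CommutativeRing.0# S))
  where
  open CommutativeRing S
  open FractionField rawRing 1≉0 *-≉0
  open Sums S
  open RawMonoidDefinitions +ᶠ-rawMonoid using () renaming (sum to sumᶠ)
  open SemiringSolver commutativeSemiring using (solve; _:+_; _:*_; _:=_; con)
  open ≈-Reasoning setoid

  -- Stronger than `x ≈ᶠ ι y`: fixing the denominator as well makes closure under the operations a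
  -- matter of congruence, with no common factor to cancel.
  record Integral (x : Frac) (y : Carrier) : Set where
    constructor _,_
    field
      num≈   : num x ≈ y
      den≈1  : den x ≈ 1#

  -- d x = y, which unlike x ≈ᶠ y / d is closed under + without cancelling.
  record Scaled (d : Carrier) (x : Frac) (y : Carrier) : Set where
    constructor mkScaled
    field scaled : num x * d ≈ y * den x

  integral-ι : ∀ x → Integral (ι x) x
  integral-ι x = refl , refl

  integral-χ : ∀ {A : Set} (A? : Dec A) → Integral (if does A? then 1ᶠ else 0ᶠ) (χ A?)
  integral-χ (yes _) = refl , refl
  integral-χ (no  _) = refl , refl

  integral-0 : Integral 0ᶠ 0#
  integral-0 = refl , refl

  integral-+ : ∀ {x x′ y y′} → Integral x y → Integral x′ y′ → Integral (x +ᶠ x′) (y + y′)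
  integral-+ (n , d) (n′ , d′) =
    +-cong (trans (*-cong n d′) (*-identityʳ _)) (trans (*-cong n′ d) (*-identityʳ _)) ,
    trans (*-cong d d′) (*-identityʳ 1#)

  integral-neg : ∀ {x y} → Integral x y → Integral (-ᶠ x) (- y)
  integral-neg (n , d) = -‿cong n , d

  integral-* : ∀ {x x′ y y′} → Integral x y → Integral x′ y′ → Integral (x *ᶠ x′) (y * y′)
  integral-* (n , d) (n′ , d′) = *-cong n n′ , trans (*-cong d d′) (*-identityʳ 1#)

  scaled-0 : ∀ d → Scaled d 0ᶠ 0#
  scaled-0 d = mkScaled (trans (zeroˡ d) (sym (zeroˡ 1#)))

  scaled-+ : ∀ d {x x′ y y′} → Scaled d x y → Scaled d x′ y′ → Scaled d (x +ᶠ x′) (y + y′)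
  scaled-+ d {x} {x′} {y} {y′} (mkScaled e) (mkScaled e′) = mkScaled (begin
    (num x * den x′ + num x′ * den x) * d
      ≈⟨ solve 5 (λ n m n′ m′ d → (n :* m′ :+ n′ :* m) :* d := n :* d :* m′ :+ n′ :* d :* m)
           refl (num x) (den x) (num x′) (den x′) d ⟩
    num x * d * den x′ + num x′ * d * den x
      ≈⟨ +-cong (*-congʳ e) (*-congʳ e′) ⟩
    y * den x * den x′ + y′ * den x′ * den x
      ≈⟨ solve 4 (λ y m y′ m′ → y :* m :* m′ :+ y′ :* m′ :* m := (y :+ y′) :* (m :* m′))
           refl y (den x) y′ (den x′) ⟩
    (y + y′) * (den x * den x′) ∎)

  scaled-* : ∀ w d (d≉0 : ¬ d ≈ 0#) {x y} → Integral x y → Scaled d ((w / d ∣ d≉0) *ᶠ x) (w * y)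
  scaled-* w d d≉0 {x} {y} (n , e) = mkScaled (begin
    w * num x * d          ≈⟨ *-congʳ (*-congˡ n) ⟩
    w * y * d              ≈⟨ *-congˡ (*-identityʳ d) ⟨
    w * y * (d * 1#)       ≈⟨ *-congˡ (*-congˡ e) ⟨
    w * y * (d * den x)    ∎)

  opaque
    unfolding ∑<

    -- One induction for both `Integral` and `Scaled d`; it replaces sums of fractions by sums in
    -- the ring.
    sum-rel : (P : Frac → Carrier → Set) → P 0ᶠ 0# →
      (∀ {x x′ y y′} → P x y → P x′ y′ → P (x +ᶠ x′) (y + y′)) →
      ∀ n {x : Fin n → Frac} {y : ℕ → Carrier} → (∀ i → P (x i) (y (toℕ i))) → P (sumᶠ x) (∑< n y)
    sum-rel P P0 P+ zero    p = P0
    sum-rel P P0 P+ (suc n) {y = y} p =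
      P+ (p Fin.zero) (sum-rel P P0 P+ n {y = λ i → y (suc i)} (λ i → p (Fin.suc i)))

  scaled-cong : ∀ {d x y y′} → y ≈ y′ → Scaled d x y → Scaled d x y′
  scaled-cong y≈y′ (mkScaled e) = mkScaled (trans e (*-congʳ y≈y′))

  sum-sum-rel : (P : Frac → Carrier → Set) → P 0ᶠ 0# →
    (∀ {x x′ y y′} → P x y → P x′ y′ → P (x +ᶠ x′) (y + y′)) →
    ∀ m n {x : Fin m → Fin n → Frac} {y : ℕ → ℕ → Carrier} →
    (∀ i j → P (x i j) (y (toℕ i) (toℕ j))) → P (sumᶠ (λ i → sumᶠ (x i))) (∑∑ m n y)
  sum-sum-rel P P0 P+ m n p = sum-rel P P0 P+ m λ i → sum-rel P P0 P+ n (p i)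

  -- As `den x` is 1, the cross-multiplied goal reduces to the `Scaled` hypothesis.
  integral-minus-fraction : ∀ {x z m k d} (d≉0 : ¬ d ≈ 0#) → Integral x m →
    Scaled d z (m * d + - k) → x -ᶠ (k / d ∣ d≉0) ≈ᶠ z
  integral-minus-fraction {x} {z} {m} {k} {d} d≉0 (n , e) (mkScaled s) = mk≈ᶠ (begin
    (num x * d + - k * den x) * den z
      ≈⟨ *-congʳ (+-cong (*-congʳ n) (trans (*-congˡ e) (*-identityʳ _))) ⟩
    (m * d + - k) * den z
      ≈⟨ s ⟨
    num z * d
      ≈⟨ *-congˡ (trans (*-congʳ e) (*-identityˡ d)) ⟨
    num z * (den x * d) ∎)

open import Defs

-- The staircase of an order ideal.

module _ {a b : ℕ} (I : J {a} {b}) where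

  private
    -- Asking for the whole rectangle of cells below (i , j), not only its top cell, makes the axis
    -- points inside vacuously.
    Inside : ℕ → ℕ → Set
    Inside i j = ∀ (x : Fin a) (y : Fin b) → toℕ x < i → toℕ y < j → (x , y) ∈ I

    inside? : ∀ i j → Dec (Inside i j)
    inside? i j = Fin.all? λ x → Fin.all? λ y →
      toℕ x ℕ.<? i →-dec toℕ y ℕ.<? j →-dec T? (member I (x , y))

  staircase : Staircase a b
  staircase = record
    { E      = λ i j → i ≤ a × j ≤ b × Inside i j
    ; E?     = λ i j → i ℕ.≤? a ×-dec j ℕ.≤? b ×-dec inside? i j
    ; pred₁  = λ (i<a , j≤b , e) → ℕ.<⇒≤ i<a , j≤b , λ x y x<i → e x y (ℕ.m<n⇒m<1+n x<i)
    ; pred₂  = λ (i≤a , j<b , e) → i≤a , ℕ.<⇒≤ j<b , λ x y x<i y<j → e x y x<i (ℕ.m<n⇒m<1+n y<j)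
    ; bound₁ = proj₁
    ; bound₂ = λ e → proj₁ (proj₂ e)
    ; axis₁  = λ i≤a → i≤a , z≤n , λ _ _ _ ()
    ; axis₂  = λ j≤b → z≤n , j≤b , λ _ _ ()
    }

  open Staircase staircase

  private
    -- Down-closure fills the rectangle below a member, so its top cell decides.
    ∈⇒E : ∀ x y → (x , y) ∈ I → E (suc (toℕ x)) (suc (toℕ y))
    ∈⇒E x y p∈I = Fin.toℕ<n x , Fin.toℕ<n y ,
      λ x′ y′ x′≤x y′≤y → downClosed I (ℕ.s≤s⁻¹ x′≤x , ℕ.s≤s⁻¹ y′≤y) p∈I

  -- A neighbouring point inside would put the next cell in that direction into `I`, above (x , y).
  -- Conversely, a larger member of `I` exceeds (x , y) in some coordinate, and by down-closure the
  -- neighbouring point in that direction is inside.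
  maximal⇔outer : ∀ x y → MaximalIn _⊑_ (_∈ I) (x , y) ⇔ OuterCorner (suc (toℕ x)) (suc (toℕ y))
  maximal⇔outer x y = mk⇔
    (λ (p∈I , max) → ∈⇒E x y p∈I ,
      -- The bound `i<a` says that `suc (toℕ x) < a`, so the cell (x + 1 , y) exists.
      (λ { (i<a , _ , e) → ℕ.1+n≢n (≡.trans (≡.sym (Fin.toℕ-fromℕ< i<a)) (≡.cong toℕ (≡.cong proj₁
        (max (fromℕ< i<a , y)
          (e _ y (s≤s (ℕ.≤-reflexive (Fin.toℕ-fromℕ< i<a))) ℕ.≤-refl)
          (≡.subst (toℕ x ≤_) (≡.sym (Fin.toℕ-fromℕ< i<a)) (ℕ.n≤1+n _) , ℕ.≤-refl))))) }) ,
      (λ { (_ , j<b , e) → ℕ.1+n≢n (≡.trans (≡.sym (Fin.toℕ-fromℕ< j<b)) (≡.cong toℕ (≡.cong proj₂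
        (max (x , fromℕ< j<b)
          (e x _ ℕ.≤-refl (s≤s (ℕ.≤-reflexive (Fin.toℕ-fromℕ< j<b))))
          (ℕ.≤-refl , ≡.subst (toℕ y ≤_) (≡.sym (Fin.toℕ-fromℕ< j<b)) (ℕ.n≤1+n _)))))) }))
    (λ ((_ , _ , e) , ¬e₁ , ¬e₂) → e x y ℕ.≤-refl ℕ.≤-refl , λ (x′ , y′) r∈I (x≤x′ , y≤y′) →
      ≡.cong₂ _,_
        (Fin.toℕ-injective (ℕ.≤-antisym (ℕ.≮⇒≥ λ x<x′ → ¬e₁ (within x′ y′ r∈I x<x′ y≤y′)) x≤x′))
        (Fin.toℕ-injective (ℕ.≤-antisym (ℕ.≮⇒≥ λ y<y′ → ¬e₂ (within x′ y′ r∈I x≤x′ y<y′)) y≤y′)))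
    where
    within : ∀ {i j} x′ y′ → (x′ , y′) ∈ I → i ≤ toℕ x′ → j ≤ toℕ y′ → E (suc i) (suc j)
    within x′ y′ r∈I i≤x′ j≤y′ with ∈⇒E x′ y′ r∈I
    ... | x′<a , y′<b , e = ℕ.≤-<-trans i≤x′ x′<a , ℕ.≤-<-trans j≤y′ y′<b ,
      λ x″ y″ x″<i y″<j → e x″ y″ (ℕ.≤-trans x″<i (s≤s i≤x′)) (ℕ.≤-trans y″<j (s≤s j≤y′))

  -- The points (x , y + 1) and (x + 1 , y) are inside exactly when every cell strictly below (x ,
  -- y) lies in `I`.
  minimal⇔inner : ∀ x y → MinimalIn _⊑_ (λ r → ¬ r ∈ I) (x , y) ⇔ InnerCorner (toℕ x) (toℕ y)
  minimal⇔inner x y = mk⇔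
    (λ (p∉I , min) →
      (λ (_ , _ , e) → p∉I (e x y ℕ.≤-refl ℕ.≤-refl)) ,
      (ℕ.<⇒≤ (Fin.toℕ<n x) , Fin.toℕ<n y , λ x′ y′ x′<x y′≤y →
        -- Minimality speaks of non-members, so membership arrives doubly negated; it is decidable,
        -- hence stable.
        decidable-stable (T? (member I (x′ , y′))) λ r∉I →
          ℕ.<-irrefl (≡.cong (λ r → toℕ (proj₁ r)) (min (x′ , y′) r∉I (ℕ.<⇒≤ x′<x , ℕ.s≤s⁻¹ y′≤y))) x′<x) ,
      (Fin.toℕ<n x , ℕ.<⇒≤ (Fin.toℕ<n y) , λ x′ y′ x′≤x y′<y →
        decidable-stable (T? (member I (x′ , y′))) λ r∉I →
          ℕ.<-irrefl (≡.cong (λ r → toℕ (proj₂ r)) (min (x′ , y′) r∉I (ℕ.s≤s⁻¹ x′≤x , ℕ.<⇒≤ y′<y))) y′<y))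
    (λ (¬e , (_ , _ , e₁) , (_ , _ , e₂)) → (λ p∈I → ¬e (∈⇒E x y p∈I)) , λ (x′ , y′) r∉I (x′≤x , y′≤y) →
      ≡.cong₂ _,_
        (Fin.toℕ-injective (ℕ.≤-antisym x′≤x (ℕ.≮⇒≥ λ x′<x → r∉I (e₁ x′ y′ x′<x (s≤s y′≤y)))))
        (Fin.toℕ-injective (ℕ.≤-antisym y′≤y (ℕ.≮⇒≥ λ y′<y → r∉I (e₂ x′ y′ (s≤s x′≤x) y′<y)))))

-- Specialisation to real polynomials in q.

private
  module ℝ[q]-ring = PolynomialRing ℝ-commutativeRing

open Sums ℝ[q]-ring.commutativeRing
-- The denominator of `1ᶠ` is `1ᴾ`, so `den≉0 1ᶠ` is the very proof of 1 ≠ 0 from which `ℝ⟨q⟩` was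
-- built, and the two fraction fields coincide.
open Fractions ℝ[q]-ring.commutativeRing (den≉0 1ᶠ) (Polynomial.*ᴾ-≉0 ℝ-commutativeRing *ᴿ-≄0)

[0]q≋0 : [ 0 ]q ≋ 0ᴾ
[0]q≋0 = CommutativeRing.refl ℝ[q]-ring.commutativeRing

[suc]q : ∀ m → [ suc m ]q ≋ 1ᴾ +ᴾ X *ᴾ [ m ]q
[suc]q m = ℝ[q]-ring.∷-as-sum 1ᴿ [ m ]q

module _ {a b : ℕ} (I : J {a} {b}) (x : Fin a) (y : Fin b) where
  open Staircase (staircase I)

  -- `T⁻` sees only the Boolean of its decision, and equivalent decisions have equal Booleans, so
  -- the corner indicator can stand in for it.
  integral-T⁻ : Integral (T⁻ (x , y) I) (χ (outerCorner? (suc (toℕ x)) (suc (toℕ y))))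
  integral-T⁻ = ≡.subst (Integral (T⁻ (x , y) I))
    (≡.cong (if_then 1ᴾ else 0ᴾ)
      (does-⇔ (maximal⇔outer I x y) (maximalInside? (x , y) I) (outerCorner? _ _)))
    (integral-χ (maximalInside? (x , y) I))

  integral-T⁺ : Integral (T⁺ (x , y) I) (χ (innerCorner? (toℕ x) (toℕ y)))
  integral-T⁺ = ≡.subst (Integral (T⁺ (x , y) I))
    (≡.cong (if_then 1ᴾ else 0ᴾ)
      (does-⇔ (minimal⇔inner I x y) (minimalOutside? (x , y) I) (innerCorner? _ _)))
    (integral-χ (minimalOutside? (x , y) I))

open import Data.Nat.Base using (_+_)
open import Data.Nat.Properties using (m≤n⇒m≤n+o)

theorem5p11 : (a b : ℕ) (1≤a : 1 ≤ a) (1≤b : 1 ≤ b) →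
    (λ (I : J {a} {b}) → ∑ (λ p → T⁻ p I))
    ≡ᵠ const ([ a ]q *ᴾ [ b ]q / [ a + b ]q ∣ [ m≤n⇒m≤n+o b 1≤a ]q-≉0)
theorem5p11 a b 1≤a 1≤b = (λ (x , y) → w (toℕ x) (toℕ y) / d ∣ d≉0) , λ I →
  -- The sum of `T⁻` is integral and the toggle combination becomes polynomial after multiplication
  -- by `d`; `weighted-toggle-sum` relates the two polynomials.
  integral-minus-fraction d≉0
    (sum-sum-rel Integral integral-0 integral-+ a b (integral-T⁻ I))
    (scaled-cong
      (weighted-toggle-sum X [_]q [0]q≋0 [suc]q a b (staircase I))
      (sum-sum-rel (Scaled d) (scaled-0 d) (scaled-+ d) a b
        λ x y → scaled-* (w (toℕ x) (toℕ y)) d d≉0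
          (integral-+ (integral-T⁺ I x y)
            (integral-neg (integral-* (integral-ι X) (integral-T⁻ I x y))))))
  where
  d = [ a + b ]q
  d≉0 = [ m≤n⇒m≤n+o b 1≤a ]q-≉0
  w = weight X [_]q [0]q≋0 [suc]q a b
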